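{- Let $p<q<r$ be odd primes such that $r=\alpha p+\beta q\le\varphi(pq)$ for some integers $\alpha,\beta>0$. Let $p'\in\{1,2,\ldots,q-1\}$ be the inverse of $p$ modulo $q$ and let $q'\in\{1,2,\ldots,p-1\}$ be the inverse of $q$ modulo $p$. Then $\Psi_{pqr}$ is flat if and only if at least one of the following conditions holds: (a) $\alpha\ge\max\{p',q-p'\}$; (b) $\beta\ge\max\{q',p-q'\}$; (c) $\alpha\ge p'$ and $\beta\ge p-q'$; (d) $\alpha\ge q-p'$ and $\beta\ge q'$.
   Context: $\varphi$ is Euler's totient function. $\Phi_n$ is the $n$th cyclotomic polynomial, and the $n$th inverse cyclotomic polynomial is $\Psi_n(x)=\dfrac{x^n-1}{\Phi_n(x)}$. The height of a polynomial is the maximal absolute value of its coefficients. A polynomial is called flat if its height equals $1$. -}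

module Defs where

open import Data.Bool using (if_then_else_)
open import Data.Integer as ℤ using (ℤ; 0ℤ; 1ℤ; -1ℤ)
open import Data.Fin using (Fin; toℕ)
open import Data.Fin.Properties using (toℕ<n)
open import Data.List using (List; []; _∷_; map; foldr; filter; length; upTo; allFin; replicate; _++_)
open import Data.List.Properties using (map-cong)
open import Data.List.Relation.Unary.All using (all?)
open import Data.Nat using (ℕ; zero; suc; _*_; _⊔_; _<_; ∣_-_∣)
open import Data.Nat.Coprimality using (coprime?)
open import Data.Nat.Divisibility using (_∣_; _∣?_)
open import Data.Nat.Induction using (<-rec; <-wellFounded)
open import Data.Product using (_×_; _,_; proj₁)
open import Function using (_∘_)
open import Induction.WellFounded using (module FixPoint)
open import Relation.Nullary using (does)
open import Relation.Binary.PropositionalEquality using (_≡_; cong)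

φ : ℕ → ℕ
φ n = length (filter (λ k → coprime? k n) (map suc (upTo n)))

infix 4 _≡_[mod_]

_≡_[mod_] : ℕ → ℕ → ℕ → Set
a ≡ b [mod n ] = n ∣ ∣ a - b ∣

record IsInverseMod (n a a′ : ℕ) : Set where
  field
    positive : 0 < a′
    bounded  : a′ < n
    inverse  : a * a′ ≡ 1 [mod n ]

-- Coefficients, constant term first.  Trailing zeros are allowed, so one
-- polynomial has many representations; neither `deg` nor `height`
-- depends on the choice.
Poly : Set
Poly = List ℤ

coeff : Poly → ℕ → ℤ
coeff []      _       = 0ℤ
coeff (a ∷ _) zero    = a
coeff (_ ∷ f) (suc i) = coeff f i

-- The zero polynomial gets degree 0.
deg : Poly → ℕ
deg []      = 0
deg (_ ∷ f) = if does (all? (ℤ._≟ 0ℤ) f) then 0 else suc (deg f)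

infixl 6 _⊕_ _⊖_
infixl 7 _·_ _⊗_ _÷_

_⊕_ : Poly → Poly → Poly
[]      ⊕ g       = g
(a ∷ f) ⊕ []      = a ∷ f
(a ∷ f) ⊕ (b ∷ g) = (a ℤ.+ b) ∷ (f ⊕ g)

_·_ : ℤ → Poly → Poly
c · f = map (c ℤ.*_) f

_⊖_ : Poly → Poly → Poly
f ⊖ g = f ⊕ (-1ℤ · g)

_⊗_ : Poly → Poly → Poly
[]      ⊗ g = []
(a ∷ f) ⊗ g = (a · g) ⊕ (0ℤ ∷ (f ⊗ g))

∏ : List Poly → Poly
∏ = foldr _⊗_ (1ℤ ∷ [])

-- Long division by a monic g: if f = q g + r with deg r < deg g, then
-- a + x f = (x q + c) g + (a + x r - c g), where c is the coefficient of
-- x ^ deg g in a + x r.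
divStep : Poly → ℤ → Poly × Poly → Poly × Poly
divStep g a (q , r) = (c ∷ q) , ((a ∷ r) ⊖ c · g)
  where c = coeff (a ∷ r) (deg g)

divMod : Poly → Poly → Poly × Poly
divMod f g = foldr (divStep g) ([] , []) f

-- The quotient for a monic divisor; both uses below are exact divisions.
_÷_ : Poly → Poly → Poly
f ÷ g = proj₁ (divMod f g)

height : Poly → ℕ
height f = foldr _⊔_ 0 (map ℤ.∣_∣ f)

Flat : Poly → Set
Flat f = height f ≡ 1

xⁿ-1 : ℕ → Poly
xⁿ-1 n = (replicate n 0ℤ ++ 1ℤ ∷ []) ⊖ (1ℤ ∷ [])

-- For n > 0 these are the positive proper divisors of n: 0 ∣ n fails.
properDivisors : (n : ℕ) → List (Fin n)
properDivisors n = filter (λ d → toℕ d ∣? n) (allFin n)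

Φ-step : (n : ℕ) → (∀ {d} → d < n → Poly) → Poly
Φ-step n Φ< = xⁿ-1 n ÷ ∏ (map (λ d → Φ< (toℕ<n d)) (properDivisors n))

-- The recursion given by x ^ n - 1 = ∏ { Φ d | d ∣ n }, for n > 0; the
-- value at 0 is junk.
Φ : ℕ → Poly
Φ = <-rec (λ _ → Poly) Φ-step

Φ-unfold : ∀ n → Φ n ≡ xⁿ-1 n ÷ ∏ (map (Φ ∘ toℕ) (properDivisors n))
Φ-unfold n = FixPoint.unfold-wfRec <-wellFounded (λ _ → Poly) Φ-step
  (λ m eq → cong (λ fs → xⁿ-1 m ÷ ∏ fs)
              (map-cong (λ d → eq (toℕ<n d)) (properDivisors m)))
  {n}

Ψ : ℕ → Poly
Ψ n = xⁿ-1 n ÷ Φ n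

module Submission where

-- Writing geo n y = 1 + y + … + y ^ (n - 1), the polynomial Ψ (p q r) is
-- Φ (p q) · (x ^ (q r) - 1) · geo p (x ^ r), where the last two factors
-- multiply to Σ { x ^ (k r) | q ≤ k < q + p } - Σ { x ^ (k r) | k < p }.
-- By Bézout, Φ (p q) = Σ x ^ a - Σ x ^ b with a = p i + q j for i < p′,
-- j < q′ and b = 1 + p i + q j for i < q - p′, j < p - q′: all these a lie in
-- the numerical semigroup generated by p and q while the a - 1 do not, and
-- the b lie outside while the b - 1 lie inside.  As r is in the semigroup,
-- no a and b differ by a multiple of r, and two a's (two b's) differ by k r
-- only if they differ by (k α, k β) in the coordinates (i, j).  Hence terms
-- of the product collide only when α < p′ and β < q′, or α < q - p′ and
-- β < p - q′.  Without a collision all coefficients are in {-1, 0, 1}; in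
-- the two other cases there is a coefficient -2 at x ^ r, respectively 2 at
-- x ^ (r + 1).

open import Defs
open import Algebra.Bundles using (CommutativeRing)
open import Data.Empty using (⊥; ⊥-elim)
open import Data.Fin using (Fin; toℕ; fromℕ<)
open import Data.Fin.Properties using (toℕ<n; toℕ-injective; toℕ-fromℕ<)
open import Data.Integer as ℤ using (ℤ; 0ℤ; 1ℤ; -1ℤ)
import Data.Integer.Properties as ℤ
import Data.Integer.Tactic.RingSolver as ℤ-Solver
open import Data.List using (List; []; _∷_; _++_; map; replicate; allFin)
open import Data.List.Membership.Propositional using (_∈_)
open import Data.List.Membership.Propositional.Properties
  using (∈-map⁺; ∈-map⁻; ∈-++⁺ˡ; ∈-++⁺ʳ; ∈-++⁻; ∈-filter⁺; ∈-filter⁻; ∈-allFin)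
open import Data.List.Membership.Propositional.Properties.WithK using (unique∧set⇒bag)
open import Data.List.Properties using (map-∘)
open import Data.List.Relation.Binary.BagAndSetEquality using (∼bag⇒↭)
open import Data.List.Relation.Binary.Permutation.Propositional using (_↭_; ↭⇒↭ₛ′)
open import Data.List.Relation.Binary.Permutation.Propositional.Properties
  using (drop-∷) renaming (map⁺ to ↭-map⁺)
import Data.List.Relation.Binary.Permutation.Setoid.Properties as ↭ₛ
open import Data.List.Relation.Unary.All as All using (All; all?)
import Data.List.Relation.Unary.All.Properties as All
open import Data.List.Relation.Unary.AllPairs using (_∷_; [])
open import Data.List.Relation.Unary.Any using (here; there)
open import Data.List.Relation.Unary.Unique.Propositional using (Unique)
import Data.List.Relation.Unary.Unique.Propositional.Properties as Unique
open import Data.Nat as ℕ using (ℕ; zero; suc)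
open import Data.Nat.Coprimality using (Coprime; coprime-Bézout; coprime-divisor; prime⇒coprime)
  renaming (sym to ⊥-sym)
open import Data.Nat.Divisibility
  using (_∣_; _∤_; divides; _∣?_; ∣-refl; ∣-trans; ∣⇒≤; 1∣_; ∣1⇒≡1; ∣n⇒∣m*n; ∣m⇒∣m*n; m∣m*n;
         *-monoˡ-∣; *-cancelʳ-∣; ∣m+n∣m⇒∣n)
open import Data.Nat.GCD using (module Bézout)
open import Data.Nat.Primality
  using (Prime; prime⇒irreducible; prime⇒nonZero; prime⇒nonTrivial; ¬prime[1]; euclidsLemma)
import Data.Nat.Properties as ℕ
import Data.Nat.Tactic.RingSolver as ℕ-Solver
open import Data.Product using (_×_; _,_; ∃; ∃₂; proj₁; proj₂)
open import Data.Sum using (_⊎_; inj₁; inj₂)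
open import Function using (_∘_; id)
open import Function.Bundles using (_⇔_; mk⇔)
open import Level using (Level; 0ℓ)
open import Relation.Binary.Bundles using (Setoid)
open import Relation.Binary.Definitions using (tri<; tri≈; tri>)
import Relation.Binary.PropositionalEquality as ≡
open ≡ using (_≡_; _≢_)
import Relation.Binary.Reasoning.Setoid as SetoidReasoning
open import Relation.Nullary using (yes; no; ¬_; contradiction)

-- Geometric sums and the quotient Φ (a b) in a commutative ring

module GeometricSums {c ℓ : Level} (R : CommutativeRing c ℓ) where
  open CommutativeRing R
  open import Algebra.Properties.Semiring.Exp semiring
  open import Algebra.Properties.Group +-group using (//-rightDividesˡ; //-rightDividesʳ)
  open SetoidReasoning setoid
  open import Algebra.Solver.Ring.NaturalCoefficients.Default commutativeSemiring
    using (solve; _:=_; _:+_; _:*_; con)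

  geo : ℕ → Carrier → Carrier
  geo zero    y = 0#
  geo (suc n) y = 1# + y * geo n y

  geo-cong : ∀ n {y z} → y ≈ z → geo n y ≈ geo n z
  geo-cong zero    y≈z = refl
  geo-cong (suc n) y≈z = +-congˡ (*-cong y≈z (geo-cong n y≈z))

  geo-congⁿ : ∀ {m n} y → m ≡ n → geo m y ≈ geo n y
  geo-congⁿ y ≡.refl = refl

  geo-+ : ∀ m n y → geo (m ℕ.+ n) y ≈ geo m y + y ^ m * geo n y
  geo-+ zero    n y = sym (trans (+-identityˡ _) (*-identityˡ _))
  geo-+ (suc m) n y = begin
    1# + y * geo (m ℕ.+ n) y              ≈⟨ +-congˡ (*-congˡ (geo-+ m n y)) ⟩
    1# + y * (geo m y + y ^ m * geo n y)
      ≈⟨ solve 4 (λ x g t h → con 1 :+ x :* (g :+ t :* h) := (con 1 :+ x :* g) :+ (x :* t) :* h)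
           refl y (geo m y) (y ^ m) (geo n y) ⟩
    1# + y * geo m y + y * y ^ m * geo n y ∎

  geo-* : ∀ m n y → geo (n ℕ.* m) y ≈ geo m y * geo n (y ^ m)
  geo-* m zero    y = sym (zeroʳ _)
  geo-* m (suc n) y = begin
    geo (m ℕ.+ n ℕ.* m) y                    ≈⟨ geo-+ m (n ℕ.* m) y ⟩
    geo m y + y ^ m * geo (n ℕ.* m) y        ≈⟨ +-congˡ (*-congˡ (geo-* m n y)) ⟩
    geo m y + y ^ m * (geo m y * geo n (y ^ m))
      ≈⟨ solve 3 (λ g t h → g :+ t :* (g :* h) := g :* (con 1 :+ t :* h))
           refl (geo m y) (y ^ m) (geo n (y ^ m)) ⟩
    geo m y * (1# + y ^ m * geo n (y ^ m))   ∎

  geo-*ʳ : ∀ m n y → geo (m ℕ.* n) y ≈ geo m y * geo n (y ^ m)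
  geo-*ʳ m n y = trans (geo-congⁿ y (ℕ.*-comm m n)) (geo-* m n y)

  geo-telescope : ∀ n y → geo n y * (y - 1#) ≈ y ^ n - 1#
  geo-telescope zero    y = trans (zeroˡ _) (sym (-‿inverseʳ 1#))
  geo-telescope (suc n) y = begin
    (1# + y * geo n y) * (y - 1#)
      ≈⟨ solve 3 (λ x g d → (con 1 :+ x :* g) :* d := d :+ x :* (g :* d)) refl y (geo n y) (y - 1#) ⟩
    (y - 1#) + y * (geo n y * (y - 1#)) ≈⟨ +-congˡ (*-congˡ (geo-telescope n y)) ⟩
    (y - 1#) + y * (y ^ n - 1#)
      ≈⟨ solve 3 (λ x t m → (x :+ m) :+ x :* (t :+ m) := x :* t :+ m :+ x :* (con 1 :+ m))
           refl y (y ^ n) (- 1#) ⟩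
    y * y ^ n - 1# + y * (1# - 1#)      ≈⟨ +-congˡ (trans (*-congˡ (-‿inverseʳ 1#)) (zeroʳ y)) ⟩
    y * y ^ n - 1# + 0#                 ≈⟨ +-identityʳ _ ⟩
    y * y ^ n - 1#                      ∎

  moveʳ : ∀ {x y z} → x ≈ y + z → x - z ≈ y
  moveʳ {y = y} {z} eq = trans (+-congʳ eq) (//-rightDividesʳ z y)

  -- Multiplied by y - 1, the fields say that
  -- g = (y - 1)(y ^ (a b) - 1) / ((y ^ a - 1)(y ^ b - 1)), so that g is
  -- Φ (a b) at y when a and b are distinct primes.
  record IsQuotient (a b : ℕ) (y g : Carrier) : Set ℓ where
    field
      clearˡ : geo a y * g ≈ geo a (y ^ b)
      clearʳ : geo b y * g ≈ geo b (y ^ a)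

  -- If a s = 1 + b t, then geo (a s) y - y geo (b t) y = 1, and factoring both sums gives geo a y ·
  -- u - v · geo b y = 1 with u = `geo s (y ^ a)` and v = `y * geo t (y ^ b)`. The formula uses
  -- these cofactors to solve both equations of `IsQuotient` without any division in the ring.
  bezoutQuotient : (a b s t : ℕ) → Carrier → Carrier
  bezoutQuotient a b s t y = geo s (y ^ a) * geo a (y ^ b) - y * geo t (y ^ b) * geo b (y ^ a)

  module _ {a b s t : ℕ} (bezout : a ℕ.* s ≡ 1 ℕ.+ b ℕ.* t) (y : Carrier) where

    private
      u v w w′ : Carrier
      u  = geo s (y ^ a)
      v  = y * geo t (y ^ b)
      w  = geo b (y ^ a)
      w′ = geo a (y ^ b)

      unit : geo a y * u ≈ 1# + v * geo b y
      unit = begin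
        geo a y * u                           ≈⟨ geo-*ʳ a s y ⟨
        geo (a ℕ.* s) y                       ≈⟨ geo-congⁿ y bezout ⟩
        1# + y * geo (b ℕ.* t) y              ≈⟨ +-congˡ (*-congˡ (geo-*ʳ b t y)) ⟩
        1# + y * (geo b y * geo t (y ^ b))
          ≈⟨ solve 3 (λ x g h → con 1 :+ x :* (g :* h) := con 1 :+ x :* h :* g)
               refl y (geo b y) (geo t (y ^ b)) ⟩
        1# + v * geo b y                      ∎

      swap : geo a y * w ≈ geo b y * w′
      swap = trans (sym (geo-*ʳ a b y)) (geo-* b a y)

      g : Carrier
      g = bezoutQuotient a b s t y

    -- Both `geo a y * w` and `geo b y * w′` equal geo (a b) y. So multiplying u w′ - v w by geo a y
    -- gives (1 + v geo b y) w′ - v geo b y w′ = w′, and multiplying by geo b y gives w in the same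
    -- way.
    bezoutQuotient-spec : IsQuotient a b y (bezoutQuotient a b s t y)
    bezoutQuotient-spec = record { clearˡ = left ; clearʳ = right }
      where
      expand : ∀ x → x * g ≈ x * (u * w′) - x * (v * w)
      expand x = trans (distribˡ x _ _) (+-congˡ (sym (-‿distribʳ-* x _)))
        where open import Algebra.Properties.Ring ring using (-‿distribʳ-*)

      left : geo a y * g ≈ w′
      left = trans (expand _) (moveʳ (begin
        geo a y * (u * w′)        ≈⟨ *-assoc _ _ _ ⟨
        geo a y * u * w′          ≈⟨ *-congʳ unit ⟩
        (1# + v * geo b y) * w′
          ≈⟨ solve 3 (λ x g h → (con 1 :+ x :* g) :* h := h :+ x :* (g :* h)) refl v (geo b y) w′ ⟩
        w′ + v * (geo b y * w′)   ≈⟨ +-congˡ (*-congˡ swap) ⟨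
        w′ + v * (geo a y * w)
          ≈⟨ solve 4 (λ z x g h → z :+ x :* (g :* h) := z :+ g :* (x :* h)) refl w′ v (geo a y) w ⟩
        w′ + geo a y * (v * w)    ∎))

      right : geo b y * g ≈ w
      right = trans (expand _) (moveʳ (begin
        geo b y * (u * w′)
          ≈⟨ solve 3 (λ g x h → g :* (x :* h) := x :* (g :* h)) refl (geo b y) u w′ ⟩
        u * (geo b y * w′)        ≈⟨ *-congˡ swap ⟨
        u * (geo a y * w)
          ≈⟨ solve 3 (λ g x h → x :* (g :* h) := g :* x :* h) refl (geo a y) u w ⟩
        geo a y * u * w           ≈⟨ *-congʳ unit ⟩
        (1# + v * geo b y) * w
          ≈⟨ solve 3 (λ x g h → (con 1 :+ x :* g) :* h := h :+ g :* (x :* h)) refl v (geo b y) w ⟩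
        w + geo b y * (v * w)     ∎))

    -- Splitting w′ after t° terms and w after s° terms leaves the tails z u T and y z′ u T, which
    -- cancel: z = y z′ because b t° = 1 + a s°. What remains is the difference of two products of
    -- short sums, in which the individual monomials can be read off.
    bezoutQuotient-explicit : ∀ {s° t°} → b ≡ s° ℕ.+ s → a ≡ t° ℕ.+ t → b ℕ.* t° ≡ 1 ℕ.+ a ℕ.* s° →
      bezoutQuotient a b s t y ≈ geo s (y ^ a) * geo t° (y ^ b) - y * (geo s° (y ^ a) * geo t (y ^ b))
    bezoutQuotient-explicit {s°} {t°} b≡ a≡ bezout° = moveʳ (begin
      u * w′                    ≈⟨ *-congˡ w′-split ⟩
      u * (T° + z * T)
        ≈⟨ solve 4 (λ u k z t → u :* (k :+ z :* t) := u :* k :+ z :* (u :* t)) refl u T° z T ⟩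
      A + z * (u * T)           ≈⟨ +-congʳ (//-rightDividesˡ B A) ⟨
      A - B + B + z * (u * T)   ≈⟨ +-assoc _ _ _ ⟩
      A - B + (B + z * (u * T)) ≈⟨ +-congˡ (+-congˡ (*-congʳ z≈)) ⟩
      A - B + (B + y * z′ * (u * T))
        ≈⟨ +-congˡ (solve 5 (λ y s t z u →
                y :* (s :* t) :+ y :* z :* (u :* t) := y :* t :* (s :+ z :* u))
             refl y S° T z′ u) ⟩
      A - B + v * (S° + z′ * u) ≈⟨ +-congˡ (*-congˡ w-split) ⟨
      A - B + v * w             ∎)
      where
      S° T T° A B z z′ : Carrier
      S° = geo s° (y ^ a)
      T  = geo t (y ^ b)
      T° = geo t° (y ^ b)
      A  = u * T°
      B  = y * (S° * T)
      z  = (y ^ b) ^ t°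
      z′ = (y ^ a) ^ s°

      w′-split : w′ ≈ T° + z * T
      w′-split = trans (geo-congⁿ (y ^ b) a≡) (geo-+ t° t (y ^ b))

      w-split : w ≈ S° + z′ * u
      w-split = trans (geo-congⁿ (y ^ a) b≡) (geo-+ s° s (y ^ a))

      z≈ : z ≈ y * z′
      z≈ = begin
        (y ^ b) ^ t°          ≈⟨ ^-assocʳ y b t° ⟩
        y ^ (b ℕ.* t°)        ≈⟨ ^-congʳ y bezout° ⟩
        y * y ^ (a ℕ.* s°)    ≈⟨ *-congˡ (^-assocʳ y a s°) ⟨
        y * (y ^ a) ^ s°      ∎

  -- The Bézout form of the quotient exhibits it as a combination of
  -- geo a (y ^ b) and geo b (y ^ a).  At y = x ^ r these are multiples of
  -- their values at y = x, hence of g.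
  bezoutQuotient-multiple :
    ∀ {a b r x g g₁ g₂} s t →
    IsQuotient a b x g → IsQuotient a r (x ^ b) g₁ → IsQuotient b r (x ^ a) g₂ →
    ∃ λ h → bezoutQuotient a b s t (x ^ r) ≈ g * h
  bezoutQuotient-multiple {a} {b} {r} {x} {g} {g₁} {g₂} s t G G₁ G₂ = h , (begin
    u * geo a (y ^ b) - v * geo b (y ^ a)
      ≈⟨ +-cong (*-congˡ (multiple a b (IsQuotient.clearˡ G) (IsQuotient.clearˡ G₁)))
                (-‿cong (*-congˡ (multiple b a (IsQuotient.clearʳ G) (IsQuotient.clearˡ G₂)))) ⟩
    u * (g * h₁) - v * (g * h₂)
      ≈⟨ +-cong (left-comm u g h₁) (trans (-‿cong (left-comm v g h₂)) (-‿distribʳ-* g _)) ⟩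
    g * (u * h₁) + g * - (v * h₂)
      ≈⟨ distribˡ g _ _ ⟨
    g * h ∎)
    where
    open import Algebra.Properties.Ring ring using (-‿distribʳ-*)
    y u v h₁ h₂ h : Carrier
    y  = x ^ r
    u  = geo s (y ^ a)
    v  = y * geo t (y ^ b)
    h₁ = geo a x * g₁
    h₂ = geo b x * g₂
    h  = u * h₁ - v * h₂

    left-comm : ∀ x y z → x * (y * z) ≈ y * (x * z)
    left-comm = solve 3 (λ x y z → x :* (y :* z) := y :* (x :* z)) refl

    multiple : ∀ m n {g′} → geo m x * g ≈ geo m (x ^ n) → geo m (x ^ n) * g′ ≈ geo m ((x ^ n) ^ r) →
      geo m ((x ^ r) ^ n) ≈ g * (geo m x * g′)
    multiple m n {g′} eq eq′ = begin
      geo m ((x ^ r) ^ n)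
        ≈⟨ geo-cong m (trans (^-assocʳ x r n) (trans (^-congʳ x (ℕ.*-comm r n)) (sym (^-assocʳ x n r)))) ⟩
      geo m ((x ^ n) ^ r)     ≈⟨ eq′ ⟨
      geo m (x ^ n) * g′      ≈⟨ *-congʳ eq ⟨
      geo m x * g * g′
        ≈⟨ solve 3 (λ m g h → m :* g :* h := g :* (m :* h)) refl (geo m x) g g′ ⟩
      g * (geo m x * g′)      ∎

  quotient : ∀ {a b} → Coprime a b → ∀ y → ∃ (IsQuotient a b y)
  quotient {a} {b} a⊥b y with coprime-Bézout a⊥b
  ... | Bézout.+- s t eq = _ , bezoutQuotient-spec
    (≡.trans (ℕ.*-comm a s) (≡.trans (≡.sym eq) (≡.cong suc (ℕ.*-comm t b)))) y
  -- `IsQuotient` is symmetric under exchanging a and b, so the other sign in Bézout's identity is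
  -- handled by swapping the two fields.
  ... | Bézout.-+ s t eq = _ , record { clearˡ = clearʳ ; clearʳ = clearˡ }
    where open IsQuotient (bezoutQuotient-spec {b} {a} {t} {s}
            (≡.trans (ℕ.*-comm b t) (≡.trans (≡.sym eq) (≡.cong suc (ℕ.*-comm s a)))) y)

  quotient-telescope : ∀ {a b y g} → IsQuotient a b y g → g * (y ^ b - 1#) * geo a y ≈ y ^ (b ℕ.* a) - 1#
  quotient-telescope {a} {b} {y} {g} G = begin
    g * (y ^ b - 1#) * geo a y
      ≈⟨ solve 3 (λ g d s → g :* d :* s := s :* g :* d) refl g (y ^ b - 1#) (geo a y) ⟩
    geo a y * g * (y ^ b - 1#)            ≈⟨ *-congʳ (IsQuotient.clearˡ G) ⟩
    geo a (y ^ b) * (y ^ b - 1#)          ≈⟨ geo-telescope a (y ^ b) ⟩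
    (y ^ b) ^ a - 1#                      ≈⟨ +-congʳ (^-assocʳ y b a) ⟩
    y ^ (b ℕ.* a) - 1#                    ∎

  -- For distinct primes a and b the four factors are the values at y of Φ 1, Φ a, Φ b and Φ (a b).
  pairProduct : ∀ {a b y g} → IsQuotient a b y g → (y - 1#) * geo a y * geo b y * g ≈ y ^ (b ℕ.* a) - 1#
  pairProduct {a} {b} {y} {g} G = begin
    (y - 1#) * geo a y * geo b y * g
      ≈⟨ solve 4 (λ d s t g → d :* s :* t :* g := g :* (t :* d) :* s)
           refl (y - 1#) (geo a y) (geo b y) g ⟩
    g * (geo b y * (y - 1#)) * geo a y    ≈⟨ *-congʳ (*-congˡ (geo-telescope b y)) ⟩
    g * (y ^ b - 1#) * geo a y            ≈⟨ quotient-telescope G ⟩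
    y ^ (b ℕ.* a) - 1#                    ∎

  -- For distinct primes a, b, c and g = Φ (a b) the left side is the product of Φ d over the proper
  -- divisors d of a b c, so the right side is a closed form of Ψ (a b c).
  tripleProduct : ∀ {a b c x g g₁ g₂} → IsQuotient a c x g₁ → IsQuotient b c x g₂ →
    (x - 1#) * geo a x * geo b x * geo c x * g * g₁ * g₂ ≈ g * ((x ^ c) ^ b - 1#) * geo a (x ^ c)
  tripleProduct {a} {b} {c} {x} {g} {g₁} {g₂} G₁ G₂ = begin
    (x - 1#) * geo a x * geo b x * geo c x * g * g₁ * g₂
      ≈⟨ solve 7 (λ d a b c g h k →
              d :* a :* b :* c :* g :* h :* k := g :* ((b :* k) :* (c :* d)) :* (a :* h))
           refl (x - 1#) (geo a x) (geo b x) (geo c x) g g₁ g₂ ⟩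
    g * ((geo b x * g₂) * (geo c x * (x - 1#))) * (geo a x * g₁)
      ≈⟨ *-cong (*-congˡ (*-cong (IsQuotient.clearˡ G₂) (geo-telescope c x))) (IsQuotient.clearˡ G₁) ⟩
    g * (geo b (x ^ c) * (x ^ c - 1#)) * geo a (x ^ c)
      ≈⟨ *-congʳ (*-congˡ (geo-telescope b (x ^ c))) ⟩
    g * ((x ^ c) ^ b - 1#) * geo a (x ^ c) ∎

  -- Subtraction-free form of
  -- g w e = (z e b₁ + e b₂) - (z e b₂ + e b₁) for g = b₁ - b₂ and w = z - 1.
  signed-product : ∀ {g w b₁ b₂ z e} → g + b₂ ≈ b₁ → w + 1# ≈ z →
    g * w * e + (z * (e * b₂) + e * b₁) ≈ z * (e * b₁) + e * b₂
  signed-product {g} {w} {b₁} {b₂} {z} {e} b₁≈ z≈ = begin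
    g * w * e + (z * (e * b₂) + e * b₁)
      ≈⟨ +-congˡ (+-cong (*-congʳ z≈) (*-congˡ b₁≈)) ⟨
    g * w * e + ((w + 1#) * (e * b₂) + e * (g + b₂))
      ≈⟨ solve 4 (λ g w e b →
              g :* w :* e :+ ((w :+ con 1) :* (e :* b) :+ e :* (g :+ b)) := (w :+ con 1) :* (e :* (g :+ b)) :+ e :* b)
           refl g w e b₂ ⟩
    (w + 1#) * (e * (g + b₂)) + e * b₂
      ≈⟨ +-congʳ (*-cong z≈ (*-congˡ b₁≈)) ⟩
    z * (e * b₁) + e * b₂ ∎

  -- Up to multiples of y², (y ^ n - 1) geo m y is -(1 + y).
  low-order : ∀ {m n g w y} → 1 ℕ.< m → 1 ℕ.< n → w + 1# ≈ y ^ n →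
    ∃₂ λ k l → g * w * geo m y + (g + (y * g + y * (y * k))) ≈ y * (y * l)
  low-order {suc (suc m)} {suc (suc n)} {g} {w} {y} (ℕ.s≤s (ℕ.s≤s _)) (ℕ.s≤s (ℕ.s≤s _)) z≈ =
    g * geo m y , y ^ n * (g * geo (2 ℕ.+ m) y) , (begin
    g * w * e + (g + (y * g + y * (y * (g * geo m y))))
      ≈⟨ solve 4 (λ g w y h → let e = con 1 :+ y :* (con 1 :+ y :* h) in
           g :* w :* e :+ (g :+ (y :* g :+ y :* (y :* (g :* h)))) := (w :+ con 1) :* (g :* e)) refl g w y (geo m y) ⟩
    (w + 1#) * (g * e)
      ≈⟨ *-congʳ z≈ ⟩
    y * (y * y ^ n) * (g * e)
      ≈⟨ solve 3 (λ y u h → y :* (y :* u) :* h := y :* (y :* (u :* h))) refl y (y ^ n) (g * e) ⟩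
    y * (y * (y ^ n * (g * e))) ∎)
    where e = geo (2 ℕ.+ m) y

open ≡ using (refl; sym; trans; cong; cong₂; subst; module ≡-Reasoning)
open import Data.Nat
  using (_+_; _*_; _∸_; _⊔_; _<_; _≤_; _≥_; _>_; z≤n; s≤s; z<s; s≤s⁻¹; ∣_-_∣;
         NonZero; >-nonZero; >-nonZero⁻¹; nonTrivial⇒n>1)
import Algebra.Properties.CommutativeSemigroup ℤ.+-commutativeSemigroup as ℤ+

-- Polynomials up to trailing zeros

infix 4 _≈_

1ₚ : Poly
1ₚ = 1ℤ ∷ []

-- A record, so that `f` and `g` can be inferred from a proof of `f ≈ g`.
record _≈_ (f g : Poly) : Set where
  constructor coeffwise
  field at : ∀ i → coeff f i ≡ coeff g i

open _≈_

≈-refl : ∀ {f} → f ≈ f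
≈-refl .at _ = refl

≈-sym : ∀ {f g} → f ≈ g → g ≈ f
≈-sym e .at i = sym (at e i)

≈-trans : ∀ {f g h} → f ≈ g → g ≈ h → f ≈ h
≈-trans d e .at i = trans (at d i) (at e i)

≈-setoid : Setoid 0ℓ 0ℓ
≈-setoid = record
  { Carrier = Poly ; _≈_ = _≈_
  ; isEquivalence = record { refl = ≈-refl ; sym = ≈-sym ; trans = ≈-trans } }

coeff-⊕ : ∀ f g i → coeff (f ⊕ g) i ≡ coeff f i ℤ.+ coeff g i
coeff-⊕ []      g       i       = sym (ℤ.+-identityˡ _)
coeff-⊕ (a ∷ f) []      i       = sym (ℤ.+-identityʳ _)
coeff-⊕ (a ∷ f) (b ∷ g) zero    = refl
coeff-⊕ (a ∷ f) (b ∷ g) (suc i) = coeff-⊕ f g i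

coeff-· : ∀ c f i → coeff (c · f) i ≡ c ℤ.* coeff f i
coeff-· c []      i       = sym (ℤ.*-zeroʳ c)
coeff-· c (a ∷ f) zero    = refl
coeff-· c (a ∷ f) (suc i) = coeff-· c f i

coeff-⊖ : ∀ f g i → coeff (f ⊖ g) i ≡ coeff f i ℤ.- coeff g i
coeff-⊖ f g i = trans (coeff-⊕ f (-1ℤ · g) i)
  (cong (ℤ._+_ (coeff f i)) (trans (coeff-· -1ℤ g i) (ℤ.-1*i≡-i (coeff g i))))

⊕-cong : ∀ {f f′ g g′} → f ≈ f′ → g ≈ g′ → f ⊕ g ≈ f′ ⊕ g′
⊕-cong {f} {f′} {g} {g′} d e .at i =
  trans (coeff-⊕ f g i) (trans (cong₂ ℤ._+_ (at d i) (at e i)) (sym (coeff-⊕ f′ g′ i)))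

·-cong : ∀ c {f g} → f ≈ g → c · f ≈ c · g
·-cong c {f} {g} e .at i =
  trans (coeff-· c f i) (trans (cong (c ℤ.*_) (at e i)) (sym (coeff-· c g i)))

∷-cong : ∀ {a b f g} → a ≡ b → f ≈ g → a ∷ f ≈ b ∷ g
∷-cong a≡b e .at zero    = a≡b
∷-cong a≡b e .at (suc i) = at e i

⊕-assoc : ∀ f g h → (f ⊕ g) ⊕ h ≈ f ⊕ (g ⊕ h)
⊕-assoc f g h .at i
  rewrite coeff-⊕ (f ⊕ g) h i | coeff-⊕ f g i | coeff-⊕ f (g ⊕ h) i | coeff-⊕ g h i
  = ℤ.+-assoc (coeff f i) (coeff g i) (coeff h i)

⊕-comm : ∀ f g → f ⊕ g ≈ g ⊕ f
⊕-comm f g .at i rewrite coeff-⊕ f g i | coeff-⊕ g f i = ℤ.+-comm (coeff f i) (coeff g i)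

⊕-identityʳ : ∀ f → f ⊕ [] ≈ f
⊕-identityʳ f .at i rewrite coeff-⊕ f [] i = ℤ.+-identityʳ (coeff f i)

⊕-interchange : ∀ f g h k → (f ⊕ g) ⊕ (h ⊕ k) ≈ (f ⊕ h) ⊕ (g ⊕ k)
⊕-interchange f g h k .at i
  rewrite coeff-⊕ (f ⊕ g) (h ⊕ k) i | coeff-⊕ f g i | coeff-⊕ h k i
        | coeff-⊕ (f ⊕ h) (g ⊕ k) i | coeff-⊕ f h i | coeff-⊕ g k i
  = ℤ+.interchange (coeff f i) (coeff g i) (coeff h i) (coeff k i)

⊖-inverseʳ : ∀ f → f ⊖ f ≈ []
⊖-inverseʳ f .at i rewrite coeff-⊖ f f i = ℤ.+-inverseʳ (coeff f i)

·-distribˡ-⊕ : ∀ c f g → c · (f ⊕ g) ≈ c · f ⊕ c · g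
·-distribˡ-⊕ c f g .at i
  rewrite coeff-· c (f ⊕ g) i | coeff-⊕ f g i | coeff-⊕ (c · f) (c · g) i | coeff-· c f i | coeff-· c g i
  = ℤ.*-distribˡ-+ c (coeff f i) (coeff g i)

·-assoc : ∀ c d f → (c ℤ.* d) · f ≈ c · (d · f)
·-assoc c d f .at i
  rewrite coeff-· (c ℤ.* d) f i | coeff-· c (d · f) i | coeff-· d f i
  = ℤ.*-assoc c d (coeff f i)

·-identity : ∀ f → 1ℤ · f ≈ f
·-identity f .at i rewrite coeff-· 1ℤ f i = ℤ.*-identityˡ (coeff f i)

·-zero : ∀ f → 0ℤ · f ≈ []
·-zero f .at i rewrite coeff-· 0ℤ f i = refl

0∷[]≈[] : 0ℤ ∷ [] ≈ []
0∷[]≈[] .at zero    = refl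
0∷[]≈[] .at (suc i) = refl

module ≈-Reasoning = SetoidReasoning ≈-setoid

⊗-congˡ : ∀ f {g h} → g ≈ h → f ⊗ g ≈ f ⊗ h
⊗-congˡ []      e = ≈-refl
⊗-congˡ (a ∷ f) e = ⊕-cong (·-cong a e) (∷-cong refl (⊗-congˡ f e))

⊗-zeroʳ : ∀ f → f ⊗ [] ≈ []
⊗-zeroʳ []      = ≈-refl
⊗-zeroʳ (a ∷ f) = ≈-trans (∷-cong refl (⊗-zeroʳ f)) 0∷[]≈[]

-- `⊗` recurses on its left factor; this is the matching recursion on the right factor, from which
-- commutativity follows by induction.
⊗-∷ : ∀ f b g → f ⊗ (b ∷ g) ≈ b · f ⊕ (0ℤ ∷ (f ⊗ g))
⊗-∷ []      b g = ≈-sym 0∷[]≈[]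
⊗-∷ (a ∷ f) b g = ∷-cong (cong (ℤ._+ 0ℤ) (ℤ.*-comm a b)) (begin
  a · g ⊕ f ⊗ (b ∷ g)                 ≈⟨ ⊕-cong ≈-refl (⊗-∷ f b g) ⟩
  a · g ⊕ (b · f ⊕ (0ℤ ∷ (f ⊗ g)))    ≈⟨ ⊕-assoc (a · g) (b · f) _ ⟨
  a · g ⊕ b · f ⊕ (0ℤ ∷ (f ⊗ g))      ≈⟨ ⊕-cong (⊕-comm (a · g) (b · f)) ≈-refl ⟩
  b · f ⊕ a · g ⊕ (0ℤ ∷ (f ⊗ g))      ≈⟨ ⊕-assoc (b · f) (a · g) _ ⟩
  b · f ⊕ (a · g ⊕ (0ℤ ∷ (f ⊗ g)))    ∎)
  where open ≈-Reasoning

⊗-comm : ∀ f g → f ⊗ g ≈ g ⊗ f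
⊗-comm []      g = ≈-sym (⊗-zeroʳ g)
⊗-comm (a ∷ f) g = ≈-trans (⊕-cong ≈-refl (∷-cong refl (⊗-comm f g))) (≈-sym (⊗-∷ g a f))

⊗-cong : ∀ {f f′ g g′} → f ≈ f′ → g ≈ g′ → f ⊗ g ≈ f′ ⊗ g′
⊗-cong {f} {f′} {g} {g′} d e = begin
  f ⊗ g    ≈⟨ ⊗-congˡ f e ⟩
  f ⊗ g′   ≈⟨ ⊗-comm f g′ ⟩
  g′ ⊗ f   ≈⟨ ⊗-congˡ g′ d ⟩
  g′ ⊗ f′  ≈⟨ ⊗-comm g′ f′ ⟩
  f′ ⊗ g′  ∎
  where open ≈-Reasoning

⊗-distribˡ-⊕ : ∀ f g h → f ⊗ (g ⊕ h) ≈ f ⊗ g ⊕ f ⊗ h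
⊗-distribˡ-⊕ []      g h = ≈-refl
⊗-distribˡ-⊕ (a ∷ f) g h = begin
  a · (g ⊕ h) ⊕ (0ℤ ∷ (f ⊗ (g ⊕ h)))
    ≈⟨ ⊕-cong (·-distribˡ-⊕ a g h) (∷-cong refl (⊗-distribˡ-⊕ f g h)) ⟩
  (a · g ⊕ a · h) ⊕ ((0ℤ ∷ (f ⊗ g)) ⊕ (0ℤ ∷ (f ⊗ h)))    ≈⟨ ⊕-interchange (a · g) (a · h) _ _ ⟩
  (a ∷ f) ⊗ g ⊕ (a ∷ f) ⊗ h                              ∎
  where open ≈-Reasoning

⊗-distribʳ-⊕ : ∀ f g h → (g ⊕ h) ⊗ f ≈ g ⊗ f ⊕ h ⊗ f
⊗-distribʳ-⊕ f g h = begin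
  (g ⊕ h) ⊗ f     ≈⟨ ⊗-comm (g ⊕ h) f ⟩
  f ⊗ (g ⊕ h)     ≈⟨ ⊗-distribˡ-⊕ f g h ⟩
  f ⊗ g ⊕ f ⊗ h   ≈⟨ ⊕-cong (⊗-comm f g) (⊗-comm f h) ⟩
  g ⊗ f ⊕ h ⊗ f   ∎
  where open ≈-Reasoning

·-⊗ : ∀ c f g → (c · f) ⊗ g ≈ c · (f ⊗ g)
·-⊗ c []      g = ≈-refl
·-⊗ c (a ∷ f) g = begin
  (c ℤ.* a) · g ⊕ (0ℤ ∷ ((c · f) ⊗ g))
    ≈⟨ ⊕-cong (·-assoc c a g) (∷-cong (sym (ℤ.*-zeroʳ c)) (·-⊗ c f g)) ⟩
  c · (a · g) ⊕ c · (0ℤ ∷ (f ⊗ g))          ≈⟨ ·-distribˡ-⊕ c (a · g) _ ⟨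
  c · ((a ∷ f) ⊗ g)                         ∎
  where open ≈-Reasoning

0∷-⊗ : ∀ f g → (0ℤ ∷ f) ⊗ g ≈ 0ℤ ∷ (f ⊗ g)
0∷-⊗ f g = ⊕-cong (·-zero g) ≈-refl

⊗-assoc : ∀ f g h → (f ⊗ g) ⊗ h ≈ f ⊗ (g ⊗ h)
⊗-assoc []      g h = ≈-refl
⊗-assoc (a ∷ f) g h = begin
  (a · g ⊕ (0ℤ ∷ (f ⊗ g))) ⊗ h            ≈⟨ ⊗-distribʳ-⊕ h (a · g) _ ⟩
  (a · g) ⊗ h ⊕ (0ℤ ∷ (f ⊗ g)) ⊗ h
    ≈⟨ ⊕-cong (·-⊗ a g h) (≈-trans (0∷-⊗ (f ⊗ g) h) (∷-cong refl (⊗-assoc f g h))) ⟩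
  (a ∷ f) ⊗ (g ⊗ h)                       ∎
  where open ≈-Reasoning

⊗-identityˡ : ∀ f → 1ₚ ⊗ f ≈ f
⊗-identityˡ f = begin
  1ℤ · f ⊕ (0ℤ ∷ [])   ≈⟨ ⊕-cong (·-identity f) 0∷[]≈[] ⟩
  f ⊕ []               ≈⟨ ⊕-identityʳ f ⟩
  f                    ∎
  where open ≈-Reasoning

polyRing : CommutativeRing 0ℓ 0ℓ
polyRing = record
  { Carrier = Poly ; _≈_ = _≈_ ; _+_ = _⊕_ ; _*_ = _⊗_ ; -_ = -1ℤ ·_ ; 0# = [] ; 1# = 1ₚ
  ; isCommutativeRing = record
    { isRing = record
      { +-isAbelianGroup = record
        { isGroup = record
          { isMonoid = record
            { isSemigroup = record
              { isMagma = record { isEquivalence = Setoid.isEquivalence ≈-setoid ; ∙-cong = ⊕-cong }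
              ; assoc = ⊕-assoc }
            ; identity = (λ _ → ≈-refl) , ⊕-identityʳ }
          ; inverse = (λ f → ≈-trans (⊕-comm (-1ℤ · f) f) (⊖-inverseʳ f)) , ⊖-inverseʳ
          ; ⁻¹-cong = ·-cong -1ℤ }
        ; comm = ⊕-comm }
      ; *-cong = ⊗-cong
      ; *-assoc = ⊗-assoc
      ; *-identity = ⊗-identityˡ , λ f → ≈-trans (⊗-comm f _) (⊗-identityˡ f)
      ; distrib = ⊗-distribˡ-⊕ , ⊗-distribʳ-⊕ }
    ; *-comm = ⊗-comm } }

open CommutativeRing polyRing
  using (semiring; commutativeSemiring; ring; +-group; *-identityʳ; *-isCommutativeMonoid; isEquivalence)
open import Algebra.Properties.Group +-group using (//-rightDividesˡ)
open import Algebra.Properties.Ring ring using (-‿distribˡ-*)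
open import Algebra.Properties.Semiring.Exp semiring using (_^_; ^-assocʳ; ^-congʳ)
open import Algebra.Solver.Ring.NaturalCoefficients.Default commutativeSemiring
  using (solve; _:=_; _:*_; con)
open GeometricSums polyRing

-- Division by monic polynomials

-- The zero polynomial has Top d 0ℤ for every d.
record Top (d : ℕ) (c : ℤ) (f : Poly) : Set where
  field
    top   : coeff f d ≡ c
    above : ∀ {i} → d < i → coeff f i ≡ 0ℤ

open Top

Monic : Poly → Set
Monic f = ∃ λ d → Top d 1ℤ f

Top-resp-≈ : ∀ {d c f g} → f ≈ g → Top d c f → Top d c g
Top-resp-≈ {d} e T .top       = trans (sym (at e d)) (top T)
Top-resp-≈ e T .above {i} d<i = trans (sym (at e i)) (above T d<i)

Monic-resp-≈ : ∀ {f g} → f ≈ g → Monic f → Monic g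
Monic-resp-≈ e (d , T) = d , Top-resp-≈ e T

Top-tail : ∀ {d c a f} → Top (suc d) c (a ∷ f) → Top d c f
Top-tail T .top       = top T
Top-tail T .above d<i = above T (s≤s d<i)

Top-⊗ : ∀ {d c e k f g} → Top d c f → Top e k g → Top (d + e) (c ℤ.* k) (f ⊗ g)
Top-⊗ {k = k} {f = []} T U .top = cong (ℤ._* k) (top T)
Top-⊗ {f = []} T U .above d<i = refl
Top-⊗ {zero} {c} {e} {k} {f = a ∷ f} {g} T U = Top-resp-≈ (≈-sym constant) scaled
  where
  f≈[] : f ≈ []
  f≈[] .at i = above T (s≤s z≤n)

  constant : (a ∷ f) ⊗ g ≈ a · g
  constant = begin
    a · g ⊕ (0ℤ ∷ (f ⊗ g))  ≈⟨ ⊕-cong ≈-refl (∷-cong refl (⊗-cong f≈[] (≈-refl {g}))) ⟩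
    a · g ⊕ (0ℤ ∷ [])       ≈⟨ ⊕-cong ≈-refl 0∷[]≈[] ⟩
    a · g ⊕ []              ≈⟨ ⊕-identityʳ (a · g) ⟩
    a · g                   ∎
    where open ≈-Reasoning

  scaled : Top e (c ℤ.* k) (a · g)
  scaled .top           = trans (coeff-· a g e) (cong₂ ℤ._*_ (top T) (top U))
  scaled .above {i} e<i = trans (coeff-· a g i) (trans (cong (a ℤ.*_) (above U e<i)) (ℤ.*-zeroʳ a))
Top-⊗ {suc d} {c} {e} {k} {f = a ∷ f} {g} T U = result
  where
  IH : Top (d + e) (c ℤ.* k) (f ⊗ g)
  IH = Top-⊗ (Top-tail T) U

  step : ∀ i → e < suc i → coeff ((a ∷ f) ⊗ g) (suc i) ≡ coeff (f ⊗ g) i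
  step i e<i
    rewrite coeff-⊕ (a · g) (0ℤ ∷ (f ⊗ g)) (suc i) | coeff-· a g (suc i) | above U e<i | ℤ.*-zeroʳ a
    = ℤ.+-identityˡ _

  result : Top (suc d + e) (c ℤ.* k) ((a ∷ f) ⊗ g)
  result .top = trans (step (d + e) (s≤s (ℕ.m≤n+m e d))) (top IH)
  result .above {suc i} (s≤s d+e<i) =
    trans (step i (s≤s (ℕ.≤-trans (ℕ.m≤n+m e d) (ℕ.<⇒≤ d+e<i)))) (above IH d+e<i)

Monic-⊗ : ∀ {f g} → Monic f → Monic g → Monic (f ⊗ g)
Monic-⊗ (_ , T) (_ , U) = _ , Top-⊗ T U

leading : ∀ f → f ≈ [] ⊎ ∃₂ λ d c → c ≢ 0ℤ × Top d c f
leading [] = inj₁ ≈-refl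
leading (a ∷ f) with leading f
... | inj₂ (d , c , c≢0 , T) = inj₂ (suc d , c , c≢0 , record
  { top = top T ; above = λ { {suc i} (s≤s d<i) → above T d<i } })
... | inj₁ f≈[] with a ℤ.≟ 0ℤ
...   | yes refl = inj₁ (≈-trans (∷-cong refl f≈[]) 0∷[]≈[])
...   | no a≢0   = inj₂ (0 , a , a≢0 , record { top = refl ; above = λ { {suc i} _ → at f≈[] i } })

Top-unique : ∀ {d c e k f} → c ≢ 0ℤ → k ≢ 0ℤ → Top d c f → Top e k f → c ≡ k
Top-unique {d} {e = e} c≢0 k≢0 T U with ℕ.<-cmp d e
... | tri< d<e _ _    = contradiction (trans (sym (top U)) (above T d<e)) k≢0
... | tri≈ _ refl _   = trans (sym (top T)) (top U)
... | tri> _ _ e<d    = contradiction (trans (sym (top T)) (above U e<d)) c≢0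

-- The leading coefficient c of `h` satisfies 1 · c = 1 by comparison with that of `g`. This yields
-- monicity of a cyclotomic polynomial from its defining product alone.
cofactor-monic : ∀ {f g h} → Monic f → Monic g → f ⊗ h ≈ g → Monic h
cofactor-monic {f} {g} {h} (_ , T) (_ , U) fh≈g with leading h
... | inj₁ h≈[] = contradiction (trans (sym (top U)) (at g≈[] _)) λ ()
  where
  g≈[] : g ≈ []
  g≈[] = ≈-trans (≈-sym fh≈g) (≈-trans (⊗-congˡ f h≈[]) (⊗-zeroʳ f))
... | inj₂ (d , c , c≢0 , V) = d , subst (λ k → Top d k h) c≡1 V
  where
  c≡1 : c ≡ 1ℤ
  c≡1 = trans (sym (ℤ.*-identityˡ c)) (Top-unique
    (λ eq → c≢0 (trans (sym (ℤ.*-identityˡ c)) eq)) (λ ()) (Top-resp-≈ fh≈g (Top-⊗ T V)) U)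

coeff-zeros : ∀ {f} → All (_≡ 0ℤ) f → ∀ i → coeff f i ≡ 0ℤ
coeff-zeros All.[]         i       = refl
coeff-zeros (z All.∷ zs) zero    = z
coeff-zeros (z All.∷ zs) (suc i) = coeff-zeros zs i

zeros : ∀ f → (∀ i → coeff f i ≡ 0ℤ) → All (_≡ 0ℤ) f
zeros []      z = All.[]
zeros (a ∷ f) z = z 0 All.∷ zeros f (λ i → z (suc i))

deg-top : ∀ {d c f} → c ≢ 0ℤ → Top d c f → deg f ≡ d
deg-top {f = []} c≢0 T = contradiction (sym (top T)) c≢0
deg-top {d} {f = a ∷ f} c≢0 T with all? (ℤ._≟ 0ℤ) f
deg-top {zero}  c≢0 T | yes _ = refl
deg-top {suc d} c≢0 T | yes zs = contradiction (trans (sym (top T)) (coeff-zeros zs d)) c≢0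
deg-top {zero}  {f = a ∷ f} c≢0 T | no ¬zs = contradiction (zeros f (λ i → above T (s≤s z≤n))) ¬zs
deg-top {suc d} c≢0 T | no _ = cong suc (deg-top c≢0 (Top-tail T))

divMod-spec : ∀ {d g} → Top d 1ℤ g → ∀ f → let (q , r) = divMod f g in
  f ≈ q ⊗ g ⊕ r × (∀ {i} → d ≤ i → coeff r i ≡ 0ℤ)
divMod-spec T [] = ≈-refl , λ _ → refl
divMod-spec {d} {g} T (a ∷ f) with divMod f g | divMod-spec T f
... | q , r | f≈ , r-small rewrite deg-top (λ ()) T = equation , small
  where
  c : ℤ
  c = coeff (a ∷ r) d

  equation : a ∷ f ≈ (c · g ⊕ (0ℤ ∷ (q ⊗ g))) ⊕ ((a ∷ r) ⊖ c · g)
  equation = ≈-trans (∷-cong (sym (ℤ.+-identityˡ a)) f≈) rearrange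
    where
    lemma : ∀ x y z → y ℤ.+ z ≡ (x ℤ.+ y) ℤ.+ (z ℤ.- x)
    lemma = ℤ-Solver.solve-∀
    rearrange : (0ℤ ∷ (q ⊗ g)) ⊕ (a ∷ r) ≈ (c · g ⊕ (0ℤ ∷ (q ⊗ g))) ⊕ ((a ∷ r) ⊖ c · g)
    rearrange .at i
      rewrite coeff-⊕ (0ℤ ∷ (q ⊗ g)) (a ∷ r) i | coeff-⊕ (c · g ⊕ (0ℤ ∷ (q ⊗ g))) ((a ∷ r) ⊖ c · g) i
            | coeff-⊕ (c · g) (0ℤ ∷ (q ⊗ g)) i | coeff-⊖ (a ∷ r) (c · g) i
      = lemma (coeff (c · g) i) (coeff (0ℤ ∷ (q ⊗ g)) i) (coeff (a ∷ r) i)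

  small : ∀ {i} → d ≤ i → coeff ((a ∷ r) ⊖ c · g) i ≡ 0ℤ
  small {i} d≤i rewrite coeff-⊖ (a ∷ r) (c · g) i | coeff-· c g i with ℕ.m≤n⇒m<n∨m≡n d≤i
  -- At the index `d` itself the coefficient c is cancelled because `g` is monic; beyond `d` both
  -- terms vanish already.
  ... | inj₂ refl rewrite top T | ℤ.*-identityʳ c = ℤ.+-inverseʳ c
  small {suc i} d≤i | inj₁ d<i rewrite above T d<i | ℤ.*-zeroʳ c | r-small (s≤s⁻¹ d<i) = refl

-- The remainder is (h - q) g. If h - q had a leading coefficient c ≠ 0 at index k, the remainder
-- would have c at index k + d, where all its coefficients vanish.
÷-exact : ∀ {f g h} → Monic g → h ⊗ g ≈ f → f ÷ g ≈ h
÷-exact {f} {g} {h} (d , T) hg≈f with divMod f g | divMod-spec T f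
... | q , r | f≈ , r-small with leading (h ⊖ q)
...   | inj₁ h⊖q≈[] = coeffwise λ i →
  sym (ℤ.i-j≡0⇒i≡j (coeff h i) (coeff q i) (trans (sym (coeff-⊖ h q i)) (at h⊖q≈[] i)))
...   | inj₂ (k , c , c≢0 , U) = contradiction c≡0 c≢0
  where
  remainder : (h ⊖ q) ⊗ g ≈ r
  remainder = begin
    (h ⊖ q) ⊗ g                ≈⟨ ⊗-distribʳ-⊕ g h (-1ℤ · q) ⟩
    h ⊗ g ⊕ (-1ℤ · q) ⊗ g      ≈⟨ ⊕-cong (≈-trans hg≈f f≈) (≈-sym (-‿distribˡ-* q g)) ⟩
    q ⊗ g ⊕ r ⊖ q ⊗ g          ≈⟨ moveʳ (⊕-comm (q ⊗ g) r) ⟩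
    r                          ∎
    where open ≈-Reasoning

  c≡0 : c ≡ 0ℤ
  c≡0 = trans (sym (ℤ.*-identityʳ c))
    (trans (sym (top (Top-resp-≈ remainder (Top-⊗ U T)))) (r-small (ℕ.m≤n+m d k)))

-- Powers of the variable

X : Poly
X = 0ℤ ∷ 1ℤ ∷ []

X⊗ : ∀ f → X ⊗ f ≈ 0ℤ ∷ f
X⊗ f = ≈-trans (0∷-⊗ 1ₚ f) (∷-cong refl (⊗-identityˡ f))

X^ : ∀ n → X ^ n ≈ replicate n 0ℤ ++ 1ℤ ∷ []
X^ zero    = ≈-refl
X^ (suc n) = ≈-trans (X⊗ (X ^ n)) (∷-cong refl (X^ n))

⊖-congˡ : ∀ {f g h} → f ≈ g → f ⊖ h ≈ g ⊖ h
⊖-congˡ f≈g = ⊕-cong f≈g ≈-refl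

xⁿ-1≈ : ∀ n → xⁿ-1 n ≈ X ^ n ⊖ 1ₚ
xⁿ-1≈ n = ⊖-congˡ (≈-sym (X^ n))

Monic-xⁿ-1 : ∀ {n} → 0 < n → Monic (xⁿ-1 n)
Monic-xⁿ-1 {suc n} _ = suc n , record
  { top = trans (coeff-⊕ (replicate n 0ℤ ++ 1ℤ ∷ []) [] n) (trans (ℤ.+-identityʳ _) (top (monomial {n})))
  ; above = λ { {suc i} (s≤s n<i) →
      trans (coeff-⊕ (replicate n 0ℤ ++ 1ℤ ∷ []) [] i) (trans (ℤ.+-identityʳ _) (above (monomial {n}) n<i)) } }
  where
  monomial : ∀ {n} → Top n 1ℤ (replicate n 0ℤ ++ 1ℤ ∷ [])
  monomial {zero}  .top               = refl
  monomial {suc n} .top               = top (monomial {n})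
  monomial {zero}  .above {suc i} _   = refl
  monomial {suc n} .above {suc i} n<i = above (monomial {n}) (s≤s⁻¹ n<i)

coeff-X^⊗ : ∀ m f n → coeff (X ^ m ⊗ f) (m + n) ≡ coeff f n
coeff-X^⊗ zero    f n = at (⊗-identityˡ f) n
coeff-X^⊗ (suc m) f n =
  trans (at (≈-trans (⊗-assoc X (X ^ m) f) (X⊗ (X ^ m ⊗ f))) (suc m + n)) (coeff-X^⊗ m f n)

coeff-X^⊗-< : ∀ {m n} f → n < m → coeff (X ^ m ⊗ f) n ≡ 0ℤ
coeff-X^⊗-< {suc m} {n}     f n<m with at (≈-trans (⊗-assoc X (X ^ m) f) (X⊗ (X ^ m ⊗ f))) n
coeff-X^⊗-< {suc m} {zero}  f n<m | eq = eq
coeff-X^⊗-< {suc m} {suc n} f n<m | eq = trans eq (coeff-X^⊗-< f (s≤s⁻¹ n<m))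

-- Cyclotomic polynomials with few prime factors

record Divisors (n : ℕ) (ds : List ℕ) : Set where
  field
    unique   : Unique ds
    sound    : ∀ {d} → d ∈ ds → d ∣ n
    complete : ∀ {d} → d ∣ n → d ∈ ds

open Divisors

divisors-↭ : ∀ {n ds es} → Divisors n ds → Divisors n es → ds ↭ es
divisors-↭ D E = ∼bag⇒↭ (unique∧set⇒bag (unique D) (unique E)
  (mk⇔ (complete E ∘ sound D) (complete D ∘ sound E)))

prime-divisors : ∀ {p} → Prime p → Divisors p (p ∷ 1 ∷ [])
prime-divisors {p} pp = record
  { unique   = (p≢1 All.∷ All.[]) ∷ All.[] ∷ []
  ; sound    = sound′
  ; complete = complete′ }
  where
  p≢1 : p ≢ 1
  p≢1 refl = ¬prime[1] pp

  sound′ : ∀ {d} → d ∈ p ∷ 1 ∷ [] → d ∣ p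
  sound′ (here refl)         = ∣-refl
  sound′ (there (here refl)) = 1∣ p

  complete′ : ∀ {d} → d ∣ p → d ∈ p ∷ 1 ∷ []
  complete′ d∣p with prime⇒irreducible pp d∣p
  ... | inj₁ refl = there (here refl)
  ... | inj₂ refl = here refl

∤⇒coprime : ∀ {p n} → Prime p → p ∤ n → Coprime p n
∤⇒coprime pp p∤n (d∣p , d∣n) with prime⇒irreducible pp d∣p
... | inj₁ d≡1  = d≡1
... | inj₂ refl = contradiction d∣n p∤n

-- A divisor of n r either is e r with e a divisor of n, or is not divisible by r, hence coprime to
-- r and a divisor of n. The two kinds do not overlap since r does not divide n.
*-prime-divisors : ∀ {n r ds} → Prime r → r ∤ n → Divisors n ds → Divisors (n * r) (map (_* r) ds ++ ds)
*-prime-divisors {n} {r} {ds} pr r∤n D = record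
  { unique   = Unique.++⁺ (Unique.map⁺ (ℕ.*-cancelʳ-≡ _ _ r) (unique D)) (unique D) disjoint
  ; sound    = sound′
  ; complete = complete′ }
  where
  instance
    r≢0 : NonZero r
    r≢0 = prime⇒nonZero pr

  disjoint : ∀ {d} → d ∈ map (_* r) ds × d ∈ ds → _
  disjoint (d∈r , d∈) with ∈-map⁻ (_* r) d∈r
  ... | e , _ , refl = r∤n (∣-trans (∣n⇒∣m*n e ∣-refl) (sound D d∈))

  sound′ : ∀ {d} → d ∈ map (_* r) ds ++ ds → d ∣ n * r
  sound′ d∈ with ∈-++⁻ (map (_* r) ds) d∈
  ... | inj₂ d∈ds = ∣m⇒∣m*n r (sound D d∈ds)
  ... | inj₁ d∈r with ∈-map⁻ (_* r) d∈r
  ...   | e , e∈ , refl = *-monoˡ-∣ r (sound D e∈)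

  complete′ : ∀ {d} → d ∣ n * r → d ∈ map (_* r) ds ++ ds
  complete′ {d} d∣nr with r ∣? d
  ... | yes (divides e refl) = ∈-++⁺ˡ (∈-map⁺ (_* r) {x = e} (complete D (*-cancelʳ-∣ r d∣nr)))
  ... | no r∤d = ∈-++⁺ʳ (map (_* r) ds) (complete D
          (coprime-divisor (⊥-sym (∤⇒coprime pr r∤d)) (subst (d ∣_) (ℕ.*-comm n r) d∣nr)))

properDivisors-divisors : ∀ {n} → 0 < n → Divisors n (n ∷ map toℕ (properDivisors n))
properDivisors-divisors {n} 0<n = record
  { unique   = All.map⁺ (All.universal (λ d n≡d → ℕ.<-irrefl (sym n≡d) (toℕ<n d)) _)
               ∷ Unique.map⁺ toℕ-injective (Unique.filter⁺ divides? (Unique.allFin⁺ n))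
  ; sound    = sound′
  ; complete = complete′ }
  where
  divides? = λ (d : Fin n) → toℕ d ∣? n

  sound′ : ∀ {d} → d ∈ n ∷ map toℕ (properDivisors n) → d ∣ n
  sound′ (here refl) = ∣-refl
  sound′ (there d∈) with ∈-map⁻ toℕ d∈
  ... | e , e∈ , refl = proj₂ (∈-filter⁻ divides? {xs = allFin n} e∈)

  complete′ : ∀ {d} → d ∣ n → d ∈ n ∷ map toℕ (properDivisors n)
  complete′ {d} d∣n with ℕ.m≤n⇒m<n∨m≡n (∣⇒≤ {{>-nonZero 0<n}} d∣n)
  ... | inj₂ refl = here refl
  ... | inj₁ d<n  = there (subst (_∈ map toℕ (properDivisors n)) d≡
                      (∈-map⁺ toℕ (∈-filter⁺ divides? (∈-allFin (fromℕ< d<n)) (subst (_∣ n) (sym d≡) d∣n))))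
    where d≡ = toℕ-fromℕ< d<n

-- Two repetition-free lists of all divisors are permutations of each other, so the product in the
-- recursion for Φ can be taken along any explicit list.
∏-properDivisors : ∀ {n ds} → 0 < n → Divisors n (n ∷ ds) → ∏ (map (Φ ∘ toℕ) (properDivisors n)) ≈ ∏ (map Φ ds)
∏-properDivisors {n} {ds} 0<n D rewrite map-∘ {g = Φ} {f = toℕ} (properDivisors n) =
  ↭ₛ.foldr-commMonoid ≈-setoid *-isCommutativeMonoid
    (↭⇒↭ₛ′ isEquivalence (↭-map⁺ Φ (drop-∷ (divisors-↭ (properDivisors-divisors 0<n) D))))

-- The recursion divides x ^ n - 1 by the product P over the proper divisors, and this division is
-- exact with quotient H. Monicity of H is returned as well because Φ n is a factor of the divisor P
-- at the next stage.
Φ-characterisation : ∀ {n ds P H} → 0 < n → Divisors n (n ∷ ds) → ∏ (map Φ ds) ≈ P → Monic P →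
  P ⊗ H ≈ xⁿ-1 n → Φ n ≈ H × Monic H
Φ-characterisation {n} {ds} {P} {H} 0<n D ∏≈P monic PH≈ =
  subst (_≈ H) (sym (Φ-unfold n))
    (÷-exact (Monic-resp-≈ (≈-sym ∏≈) monic) (≈-trans (⊗-comm H _) (≈-trans (⊗-cong ∏≈ ≈-refl) PH≈)))
  , cofactor-monic monic (Monic-xⁿ-1 0<n) PH≈
  where
  ∏≈ : ∏ (map (Φ ∘ toℕ) (properDivisors n)) ≈ P
  ∏≈ = ≈-trans (∏-properDivisors 0<n D) ∏≈P

1-divisors : Divisors 1 (1 ∷ [])
1-divisors = record
  { unique   = All.[] ∷ []
  ; sound    = λ { (here refl) → 1∣ 1 }
  ; complete = λ d∣1 → here (∣1⇒≡1 d∣1) }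

Monic-1 : Monic 1ₚ
Monic-1 = 0 , record { top = refl ; above = λ { {suc i} _ → refl } }

Φ₁ : Φ 1 ≈ X ⊖ 1ₚ × Monic (X ⊖ 1ₚ)
Φ₁ = Φ-characterisation z<s 1-divisors ≈-refl Monic-1
  (≈-trans (⊗-identityˡ (X ⊖ 1ₚ)) (≈-sym (≈-trans (xⁿ-1≈ 1) (⊖-congˡ {h = 1ₚ} (*-identityʳ X)))))

prime⇒>0 : ∀ {p} → Prime p → 0 < p
prime⇒>0 {p} pp = >-nonZero⁻¹ p {{prime⇒nonZero pp}}

Φ-prime : ∀ {p} → Prime p → Φ p ≈ geo p X × Monic (geo p X)
Φ-prime {p} pp = Φ-characterisation (prime⇒>0 pp) (prime-divisors pp)
  (≈-trans (*-identityʳ (Φ 1)) (proj₁ Φ₁)) (proj₂ Φ₁)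
  (let open ≈-Reasoning in begin
    (X ⊖ 1ₚ) ⊗ geo p X   ≈⟨ ⊗-comm (X ⊖ 1ₚ) (geo p X) ⟩
    geo p X ⊗ (X ⊖ 1ₚ)   ≈⟨ geo-telescope p X ⟩
    X ^ p ⊖ 1ₚ           ≈⟨ xⁿ-1≈ p ⟨
    xⁿ-1 p                      ∎)

pq-divisors : ∀ {p q} → Prime p → Prime q → q ∤ p → Divisors (p * q) (p * q ∷ 1 * q ∷ p ∷ 1 ∷ [])
pq-divisors pp pq q∤p = *-prime-divisors pq q∤p (prime-divisors pp)

Φ-pq : ∀ {p q g} → Prime p → Prime q → q ∤ p → IsQuotient p q X g → Φ (p * q) ≈ g × Monic g
Φ-pq {p} {q} {g} pp pq q∤p G = Φ-characterisation
  (ℕ.*-mono-< (prime⇒>0 pp) (prime⇒>0 pq)) (pq-divisors pp pq q∤p)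
  (let open ≈-Reasoning in begin
    Φ (1 * q) ⊗ (Φ p ⊗ (Φ 1 ⊗ 1ₚ))
      ≡⟨ cong (λ m → Φ m ⊗ (Φ p ⊗ (Φ 1 ⊗ 1ₚ))) (ℕ.*-identityˡ q) ⟩
    Φ q ⊗ (Φ p ⊗ (Φ 1 ⊗ 1ₚ))
      ≈⟨ solve 3 (λ a b c → c :* (b :* (a :* con 1)) := a :* b :* c) ≈-refl (Φ 1) (Φ p) (Φ q) ⟩
    Φ 1 ⊗ Φ p ⊗ Φ q
      ≈⟨ ⊗-cong (⊗-cong (proj₁ Φ₁) (proj₁ (Φ-prime pp))) (proj₁ (Φ-prime pq)) ⟩
    (X ⊖ 1ₚ) ⊗ geo p X ⊗ geo q X ∎)
  (Monic-⊗ (Monic-⊗ (proj₂ Φ₁) (proj₂ (Φ-prime pp))) (proj₂ (Φ-prime pq)))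
  (≈-trans (pairProduct G) (≈-trans (⊖-congˡ (^-congʳ X (ℕ.*-comm q p))) (≈-sym (xⁿ-1≈ (p * q)))))

-- The proper divisors of p q r contribute the product P, which equals the claimed value Q by
-- `tripleProduct`. A cofactor h with Q h = x ^ (p q r) - 1 then has to be Φ (p q r), and dividing
-- by it gives back Q.
Ψ-pqr : ∀ {p q r s t} → Prime p → Prime q → Prime r → p < q → q < r → p * s ≡ 1 + q * t →
  Ψ (p * q * r) ≈ bezoutQuotient p q s t X ⊗ ((X ^ r) ^ q ⊖ 1ₚ) ⊗ geo p (X ^ r)
Ψ-pqr {p} {q} {r} {s} {t} pp pq pr p<q q<r bezout = ÷-exact monic (≈-trans (⊗-congˡ Q (proj₁ Φpqr)) Q⊗h)
  where
  open ≈-Reasoning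

  >⇒∤ : ∀ {m n} → 0 < m → m < n → n ∤ m
  >⇒∤ 0<m m<n n∣m = ℕ.<⇒≱ m<n (∣⇒≤ {{>-nonZero 0<m}} n∣m)

  p<r : p < r
  p<r = ℕ.<-trans p<q q<r

  q∤p : q ∤ p
  q∤p = >⇒∤ (prime⇒>0 pp) p<q

  r∤p : r ∤ p
  r∤p = >⇒∤ (prime⇒>0 pp) p<r

  r∤q : r ∤ q
  r∤q = >⇒∤ (prime⇒>0 pq) q<r

  r∤pq : r ∤ p * q
  r∤pq r∣pq with euclidsLemma p q pr r∣pq
  ... | inj₁ r∣p = r∤p r∣p
  ... | inj₂ r∣q = r∤q r∣q

  p⊥r : Coprime p r
  p⊥r = ⊥-sym (∤⇒coprime pr r∤p)

  q⊥r : Coprime q r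
  q⊥r = ⊥-sym (∤⇒coprime pr r∤q)

  g g₁ g₂ : Poly
  g  = bezoutQuotient p q s t X
  g₁ = proj₁ (quotient p⊥r X)
  g₂ = proj₁ (quotient q⊥r X)

  G : IsQuotient p q X g
  G = bezoutQuotient-spec bezout X

  G₁ : IsQuotient p r X g₁
  G₁ = proj₂ (quotient p⊥r X)

  G₂ : IsQuotient q r X g₂
  G₂ = proj₂ (quotient q⊥r X)

  -- This is the identity Φ (p q) (x ^ r) = Φ (p q) · Φ (p q r), with `h` in the role of the last
  -- factor.
  multiple : ∃ λ h → bezoutQuotient p q s t (X ^ r) ≈ g ⊗ h
  multiple = bezoutQuotient-multiple s t G (proj₂ (quotient p⊥r (X ^ q))) (proj₂ (quotient q⊥r (X ^ p)))

  h w P Q : Poly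
  h = proj₁ multiple
  w = (X ^ r) ^ q ⊖ 1ₚ
  P = (X ⊖ 1ₚ) ⊗ geo p X ⊗ geo q X ⊗ geo r X ⊗ g ⊗ g₁ ⊗ g₂
  Q = g ⊗ w ⊗ geo p (X ^ r)

  P≈Q : P ≈ Q
  P≈Q = tripleProduct G₁ G₂

  Q⊗h : Q ⊗ h ≈ xⁿ-1 (p * q * r)
  Q⊗h = begin
    g ⊗ w ⊗ geo p (X ^ r) ⊗ h
      ≈⟨ solve 4 (λ g w e h → g :* w :* e :* h := g :* h :* w :* e) ≈-refl g w (geo p (X ^ r)) h ⟩
    g ⊗ h ⊗ w ⊗ geo p (X ^ r)
      ≈⟨ ⊗-cong (⊗-cong (proj₂ multiple) (≈-refl {w})) (≈-refl {geo p (X ^ r)}) ⟨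
    bezoutQuotient p q s t (X ^ r) ⊗ w ⊗ geo p (X ^ r)
      ≈⟨ quotient-telescope {p} {q} (bezoutQuotient-spec {p} {q} {s} {t} bezout (X ^ r)) ⟩
    (X ^ r) ^ (q * p) ⊖ 1ₚ
      ≈⟨ ⊖-congˡ (≈-trans (^-assocʳ X r (q * p))
                      (^-congʳ X (trans (ℕ.*-comm r (q * p)) (cong (_* r) (ℕ.*-comm q p))))) ⟩
    X ^ (p * q * r) ⊖ 1ₚ
      ≈⟨ xⁿ-1≈ (p * q * r) ⟨
    xⁿ-1 (p * q * r) ∎

  Φpq = Φ-pq pp pq q∤p G
  Φpr = Φ-pq pp pr r∤p G₁
  Φqr = Φ-pq pq pr r∤q G₂

  Φpqr : Φ (p * q * r) ≈ h × Monic h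
  Φpqr = Φ-characterisation {P = P} (ℕ.*-mono-< (ℕ.*-mono-< (prime⇒>0 pp) (prime⇒>0 pq)) (prime⇒>0 pr))
    (*-prime-divisors pr r∤pq (pq-divisors pp pq q∤p))
    (begin
      Φ (1 * q * r) ⊗ (Φ (p * r) ⊗ (Φ (1 * r) ⊗ (Φ (p * q) ⊗ (Φ (1 * q) ⊗ (Φ p ⊗ (Φ 1 ⊗ 1ₚ))))))
        ≡⟨ cong₂ (λ k l → Φ (k * r) ⊗ (Φ (p * r) ⊗ (Φ l ⊗ (Φ (p * q) ⊗ (Φ k ⊗ (Φ p ⊗ (Φ 1 ⊗ 1ₚ)))))))
             (ℕ.*-identityˡ q) (ℕ.*-identityˡ r) ⟩
      Φ (q * r) ⊗ (Φ (p * r) ⊗ (Φ r ⊗ (Φ (p * q) ⊗ (Φ q ⊗ (Φ p ⊗ (Φ 1 ⊗ 1ₚ))))))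
        ≈⟨ solve 7 (λ a b c d e f g → g :* (f :* (d :* (e :* (c :* (b :* (a :* con 1)))))) := a :* b :* c :* d :* e :* f :* g)
             ≈-refl (Φ 1) (Φ p) (Φ q) (Φ r) (Φ (p * q)) (Φ (p * r)) (Φ (q * r)) ⟩
      Φ 1 ⊗ Φ p ⊗ Φ q ⊗ Φ r ⊗ Φ (p * q) ⊗ Φ (p * r) ⊗ Φ (q * r)
        ≈⟨ ⊗-cong (⊗-cong (⊗-cong (⊗-cong (⊗-cong (⊗-cong
              (proj₁ Φ₁) (proj₁ (Φ-prime pp))) (proj₁ (Φ-prime pq))) (proj₁ (Φ-prime pr)))
              (proj₁ Φpq)) (proj₁ Φpr)) (proj₁ Φqr) ⟩
      P ∎)
    (Monic-⊗ (Monic-⊗ (Monic-⊗ (Monic-⊗ (Monic-⊗ (Monic-⊗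
      (proj₂ Φ₁) (proj₂ (Φ-prime pp))) (proj₂ (Φ-prime pq))) (proj₂ (Φ-prime pr)))
      (proj₂ Φpq)) (proj₂ Φpr)) (proj₂ Φqr))
    (≈-trans (⊗-cong P≈Q (≈-refl {h})) Q⊗h)

  monic : Monic (Φ (p * q * r))
  monic = Monic-resp-≈ (≈-sym (proj₁ Φpqr)) (proj₂ Φpqr)

-- Polynomials with coefficients 0 and 1

height-≤ : ∀ f {k} → (∀ n → ℤ.∣ coeff f n ∣ ≤ k) → height f ≤ k
height-≤ []      b = z≤n
height-≤ (a ∷ f) b = ℕ.⊔-lub (b 0) (height-≤ f (λ n → b (suc n)))

coeff≤height : ∀ f n → ℤ.∣ coeff f n ∣ ≤ height f
coeff≤height []      n       = z≤n
coeff≤height (a ∷ f) zero    = ℕ.m≤m⊔n _ _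
coeff≤height (a ∷ f) (suc n) = ℕ.≤-trans (coeff≤height f n) (ℕ.m≤n⊔m ℤ.∣ a ∣ _)

-- `f` is the generating polynomial Σ { x ^ n | A n } of the set `A`; `split` decides membership in
-- `A` at the same time.
record Indicator (f : Poly) (A : ℕ → Set) : Set where
  field split : ∀ n → (A n × coeff f n ≡ 1ℤ) ⊎ (¬ A n × coeff f n ≡ 0ℤ)

open Indicator

module _ {f : Poly} {A : ℕ → Set} (I : Indicator f A) where

  indicator-∈ : ∀ {n} → A n → coeff f n ≡ 1ℤ
  indicator-∈ {n} a with split I n
  ... | inj₁ (_ , eq) = eq
  ... | inj₂ (¬a , _) = contradiction a ¬a

  indicator-∉ : ∀ {n} → ¬ A n → coeff f n ≡ 0ℤ
  indicator-∉ {n} ¬a with split I n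
  ... | inj₁ (a , _) = contradiction a ¬a
  ... | inj₂ (_ , eq) = eq

  indicator-resp : ∀ {g} {B : ℕ → Set} → f ≈ g → (∀ {n} → A n → B n) → (∀ {n} → B n → A n) → Indicator g B
  indicator-resp f≈g A⊆B B⊆A .split n with split I n
  ... | inj₁ (a , eq)  = inj₁ (A⊆B a , trans (sym (at f≈g n)) eq)
  ... | inj₂ (¬a , eq) = inj₂ ((λ b → ¬a (B⊆A b)) , trans (sym (at f≈g n)) eq)

  indicator-⊕ : ∀ {g} {B : ℕ → Set} → Indicator g B → (∀ {n} → A n → B n → ⊥) →
    Indicator (f ⊕ g) (λ n → A n ⊎ B n)
  indicator-⊕ {g} J disjoint .split n rewrite coeff-⊕ f g n with split I n | split J n
  ... | inj₁ (a , _)   | inj₁ (b , _)   = ⊥-elim (disjoint a b)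
  ... | inj₁ (a , eq)  | inj₂ (_ , eq′) = inj₁ (inj₁ a , cong₂ ℤ._+_ eq eq′)
  ... | inj₂ (_ , eq)  | inj₁ (b , eq′) = inj₁ (inj₂ b , cong₂ ℤ._+_ eq eq′)
  ... | inj₂ (¬a , eq) | inj₂ (¬b , eq′) = inj₂ ((λ { (inj₁ a) → ¬a a ; (inj₂ b) → ¬b b }) , cong₂ ℤ._+_ eq eq′)

Shift : ℕ → (ℕ → Set) → ℕ → Set
Shift m A n = ∃ λ a → A a × n ≡ m + a

-- The exponents occurring in geo N (x ^ m) · Σ { x ^ a | A a } before any collection of equal
-- terms.
Steps : ℕ → ℕ → (ℕ → Set) → ℕ → Set
Steps N m A n = ∃ λ i → i < N × Shift (i * m) A n

indicator-X^ : ∀ {f A} m → Indicator f A → Indicator (X ^ m ⊗ f) (Shift m A)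
indicator-X^ {f} {A} m I .split n with n ℕ.<? m
... | yes n<m = inj₂ ((λ { (a , _ , refl) → ℕ.m+n≮m m a n<m }) , coeff-X^⊗-< f n<m)
... | no n≮m  = shifted (split I (n ∸ m))
  where
  n≡ : n ≡ m + (n ∸ m)
  n≡ = sym (ℕ.m+[n∸m]≡n (ℕ.≮⇒≥ n≮m))

  coeff-n : coeff (X ^ m ⊗ f) n ≡ coeff f (n ∸ m)
  coeff-n = trans (cong (coeff (X ^ m ⊗ f)) n≡) (coeff-X^⊗ m f (n ∸ m))

  shifted : A (n ∸ m) × coeff f (n ∸ m) ≡ 1ℤ ⊎ ¬ A (n ∸ m) × coeff f (n ∸ m) ≡ 0ℤ →
    Shift m A n × coeff (X ^ m ⊗ f) n ≡ 1ℤ ⊎ ¬ Shift m A n × coeff (X ^ m ⊗ f) n ≡ 0ℤ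
  shifted (inj₁ (a , eq))  = inj₁ ((n ∸ m , a , n≡) , trans coeff-n eq)
  shifted (inj₂ (¬a , eq)) =
    inj₂ ((λ { (a , Aa , refl) → ¬a (subst A (sym (ℕ.m+n∸m≡n m a)) Aa) }) , trans coeff-n eq)

-- The last hypothesis keeps the translates of `A` by 0, m, ..., (N - 1) m pairwise disjoint, so no
-- coefficient exceeds 1. The induction splits off the untranslated copy.
indicator-geo : ∀ {f A} N m → Indicator f A →
  (∀ {i a a′} → suc i < N → A a → A a′ → a ≢ suc i * m + a′) →
  Indicator (geo N (X ^ m) ⊗ f) (Steps N m A)
indicator-geo         zero    m I spread .split n = inj₂ ((λ ()) , refl)
indicator-geo {f} {A} (suc N) m I spread =
  indicator-resp (indicator-⊕ I (indicator-X^ m tail) disjoint) (≈-sym unfold) to from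
  where
  tail : Indicator (geo N (X ^ m) ⊗ f) (Steps N m A)
  tail = indicator-geo N m I (λ i<N → spread (ℕ.m<n⇒m<1+n i<N))

  G : Poly
  G = geo N (X ^ m)

  unfold : geo (suc N) (X ^ m) ⊗ f ≈ f ⊕ X ^ m ⊗ (G ⊗ f)
  unfold = ≈-trans (⊗-distribʳ-⊕ f 1ₚ (X ^ m ⊗ G)) (⊕-cong (⊗-identityˡ f) (⊗-assoc (X ^ m) G f))

  disjoint : ∀ {n} → A n → Shift m (Steps N m A) n → ⊥
  disjoint a (_ , (i , i<N , a′ , Aa′ , refl) , n≡) =
    spread (s≤s i<N) a Aa′ (trans n≡ (sym (ℕ.+-assoc m (i * m) a′)))

  to : ∀ {n} → A n ⊎ Shift m (Steps N m A) n → Steps (suc N) m A n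
  to (inj₁ a) = 0 , z<s , _ , a , refl
  to (inj₂ (_ , (i , i<N , a′ , Aa′ , refl) , refl)) = suc i , s≤s i<N , a′ , Aa′ , sym (ℕ.+-assoc m (i * m) a′)

  from : ∀ {n} → Steps (suc N) m A n → A n ⊎ Shift m (Steps N m A) n
  from (zero  , _       , a , Aa , refl) = inj₁ Aa
  from (suc i , s≤s i<N , a , Aa , refl) = inj₂ (i * m + a , (i , i<N , a , Aa , refl) , ℕ.+-assoc m (i * m) a)

indicator-1 : Indicator 1ₚ (_≡ 0)
indicator-1 .split zero    = inj₁ (refl , refl)
indicator-1 .split (suc n) = inj₂ ((λ ()) , refl)

-- Representations p i + q j

-- If u < x, then p (x - u) + q y = q v makes q a divisor of x - u, although 0 < x - u < q. Hence x
-- ≤ u, and comparing the remaining multiples of q gives v ≤ y.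
combination-≤ : ∀ {p q x y u v} → Coprime p q → x < q → p * x + q * y ≡ p * u + q * v → x ≤ u × v ≤ y
combination-≤ {p} {q} {x} {y} {u} {v} p⊥q x<q eq with ℕ.≤-<-connex x u
... | inj₁ x≤u = x≤u , ℕ.*-cancelˡ-≤ q {{q≢0}} (ℕ.+-cancelˡ-≤ (p * u) (q * v) (q * y)
        (ℕ.≤-trans (ℕ.≤-reflexive (sym eq)) (ℕ.+-monoˡ-≤ (q * y) (ℕ.*-monoʳ-≤ p x≤u))))
  where q≢0 = >-nonZero (ℕ.≤-<-trans z≤n x<q)
... | inj₂ u<x = contradiction (∣⇒≤ {{>-nonZero (ℕ.m<n⇒0<n∸m u<x)}} q∣d) (ℕ.<⇒≱ (ℕ.≤-<-trans (ℕ.m∸n≤m x u) x<q))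
  where
  d : ℕ
  d = x ∸ u

  eq′ : q * y + p * d ≡ q * v
  eq′ = ℕ.+-cancelˡ-≡ (p * u) _ _ (trans (lemma p q u d y)
    (trans (cong (λ z → p * z + q * y) (ℕ.m+[n∸m]≡n (ℕ.<⇒≤ u<x))) eq))
    where
    lemma : ∀ p q u d y → p * u + (q * y + p * d) ≡ p * (u + d) + q * y
    lemma = ℕ-Solver.solve-∀

  q∣d : q ∣ d
  q∣d = coprime-divisor (⊥-sym p⊥q) (∣m+n∣m⇒∣n (subst (q ∣_) (sym eq′) (m∣m*n v)) (m∣m*n y))

combination-≡ : ∀ {p q x y u v} → Coprime p q → x < q → y < p → p * x + q * y ≡ p * u + q * v → x ≡ u × y ≡ v
combination-≡ {p} {q} {x} {y} {u} {v} p⊥q x<q y<p eq =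
  ℕ.≤-antisym x≤u u≤x , ℕ.≤-antisym y≤v v≤y
  where
  x≤u = proj₁ (combination-≤ p⊥q x<q eq)
  v≤y = proj₂ (combination-≤ p⊥q x<q eq)
  swapped : q * y + p * x ≡ q * v + p * u
  swapped = trans (ℕ.+-comm (q * y) (p * x)) (trans eq (ℕ.+-comm (p * u) (q * v)))
  y≤v = proj₁ (combination-≤ (⊥-sym p⊥q) y<p swapped)
  u≤x = proj₂ (combination-≤ (⊥-sym p⊥q) y<p swapped)

Box : (p q s t : ℕ) → ℕ → Set
Box p q s t n = ∃ λ i → ∃ λ j → i < s × j < t × n ≡ p * i + q * j

box : (p q s t : ℕ) → Poly
box p q s t = geo s (X ^ p) ⊗ geo t (X ^ q)

indicator-box : ∀ {p q s t} → Coprime p q → 0 < q → s ≤ q → Indicator (box p q s t) (Box p q s t)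
indicator-box {p} {q} {s} {t} p⊥q 0<q s≤q =
  indicator-resp (indicator-geo s p (indicator-geo t q indicator-1 inner) outer)
    (⊗-congˡ (geo s (X ^ p)) (*-identityʳ _)) to from
  where
  inner : ∀ {i a a′} → suc i < t → a ≡ 0 → a′ ≡ 0 → a ≢ suc i * q + a′
  inner _ refl refl eq = ℕ.<⇒≢ (ℕ.<-≤-trans 0<q (ℕ.≤-trans (ℕ.m≤m+n q _) (ℕ.m≤m+n _ 0))) eq

  reorder : ∀ p q i j → p * i + q * j ≡ i * p + (j * q + 0)
  reorder = ℕ-Solver.solve-∀

  outer : ∀ {i a a′} → suc i < s → Steps t q (_≡ 0) a → Steps t q (_≡ 0) a′ → a ≢ suc i * p + a′
  outer {i} i<s (j , _ , _ , refl , refl) (j′ , _ , _ , refl , refl) eq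
    -- Both numbers would represent the same sum with p-coordinates suc i < q and 0, which forces
    -- suc i ≤ 0.
    with () ← proj₁ (combination-≤ {p} {q} {suc i} {j′} {0} {j} p⊥q (ℕ.<-≤-trans i<s s≤q)
                       (trans (reorder p q (suc i) j′) (trans (sym eq) (sym (reorder p q 0 j)))))

  to : ∀ {n} → Steps s p (Steps t q (_≡ 0)) n → Box p q s t n
  to (i , i<s , _ , (j , j<t , _ , refl , refl) , refl) = i , j , i<s , j<t , sym (reorder p q i j)

  from : ∀ {n} → Box p q s t n → Steps s p (Steps t q (_≡ 0)) n
  from (i , j , i<s , j<t , refl) = i , i<s , _ , (j , j<t , _ , refl , refl) , reorder p q i j

-- The flatness criterion

-- To be used with s = p′, s° = q - p′, t = p - q′ and t° = q′, when
-- Φ (p q) = plus - minus.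
module FlatnessCriterion
  {p q r α β s s° t t° : ℕ} (p⊥q : Coprime p q) (1<p : 1 < p) (p<q : p < q) (q<r : q < r)
  (r≡ : r ≡ α * p + β * q) (q≡ : q ≡ s° + s) (p≡ : p ≡ t° + t)
  (0<s : 0 < s) (0<s° : 0 < s°) (0<t : 0 < t) (0<t° : 0 < t°)
  (bezout : p * s ≡ 1 + q * t) (bezout° : q * t° ≡ 1 + p * s°)
  where

  private
    difference : ∀ x y w → x ℤ.+ y ≡ w → x ≡ w ℤ.- y
    difference x y w eq = trans (lemma x y) (cong (ℤ._- y) eq)
      where
      lemma : ∀ x y → x ≡ x ℤ.+ y ℤ.- y
      lemma = ℤ-Solver.solve-∀

    r≡′ : r ≡ p * α + q * β
    r≡′ = trans r≡ (cong₂ _+_ (ℕ.*-comm α p) (ℕ.*-comm β q))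

  0<q : 0 < q
  0<q = ℕ.≤-<-trans z≤n p<q

  1<r : 1 < r
  1<r = ℕ.<-trans 1<p (ℕ.<-trans p<q q<r)

  s≤q : s ≤ q
  s≤q = ℕ.≤-trans (ℕ.m≤n+m s s°) (ℕ.≤-reflexive (sym q≡))

  s°≤q : s° ≤ q
  s°≤q = ℕ.≤-trans (ℕ.m≤m+n s° s) (ℕ.≤-reflexive (sym q≡))

  t≤p : t ≤ p
  t≤p = ℕ.≤-trans (ℕ.m≤n+m t t°) (ℕ.≤-reflexive (sym p≡))

  t°≤p : t° ≤ p
  t°≤p = ℕ.≤-trans (ℕ.m≤m+n t° t) (ℕ.≤-reflexive (sym p≡))

  Plus Minus : ℕ → Set
  Plus  = Box p q s t°
  Minus = Shift 1 (Box p q s° t)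

  plus minus : Poly
  plus  = box p q s t°
  minus = X ⊗ box p q s° t

  plus-indicator : Indicator plus Plus
  plus-indicator = indicator-box p⊥q 0<q s≤q

  minus-indicator : Indicator minus Minus
  minus-indicator = indicator-resp (indicator-X^ 1 (indicator-box p⊥q 0<q s°≤q))
    (⊗-cong (*-identityʳ X) ≈-refl) id id

  -- The exponents of `minus` lie outside the semigroup generated by p and q: adding p s = 1 + q t
  -- to the equation gives p (i + s) + q j = p u + q (v + t) with i + s < q, hence t ≤ j.
  minus∉ : ∀ {i j u v} → i < s° → j < t → 1 + (p * i + q * j) ≢ p * u + q * v
  minus∉ {i} {j} {u} {v} i<s° j<t eq = ℕ.<⇒≱ j<t (ℕ.≤-trans (ℕ.m≤n+m t v) (proj₂ bounds))
    where
    lemma : ∀ p q i j s t u v → p * s ≡ 1 + q * t → 1 + (p * i + q * j) ≡ p * u + q * v →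
      p * (i + s) + q * j ≡ p * u + q * (v + t)
    lemma p q i j s t u v ps eq = trans (l₁ p q i j s) (trans (cong (λ z → z + p * i + q * j) ps)
      (trans (l₂ p q i j t) (trans (cong (_+ q * t) eq) (l₃ p q u v t))))
      where
      l₁ : ∀ p q i j s → p * (i + s) + q * j ≡ p * s + p * i + q * j
      l₁ = ℕ-Solver.solve-∀
      l₂ : ∀ p q i j t → 1 + q * t + p * i + q * j ≡ 1 + (p * i + q * j) + q * t
      l₂ = ℕ-Solver.solve-∀
      l₃ : ∀ p q u v t → p * u + q * v + q * t ≡ p * u + q * (v + t)
      l₃ = ℕ-Solver.solve-∀

    bounds : i + s ≤ u × v + t ≤ j
    bounds = combination-≤ p⊥q (ℕ.<-≤-trans (ℕ.+-monoˡ-< s i<s°) (ℕ.≤-reflexive (sym q≡)))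
      (lemma p q i j s t u v bezout eq)

  -- An exponent of `plus` lowered by 1 lies outside the semigroup: adding p s° and replacing 1 + p
  -- s° by q t° gives p (s° + i) + q j = p u + q (v + t°) with s° + i < q, hence t° ≤ j.
  plus∉ : ∀ {i j u v} → i < s → j < t° → p * i + q * j ≢ 1 + (p * u + q * v)
  plus∉ {i} {j} {u} {v} i<s j<t° eq = ℕ.<⇒≱ j<t° (ℕ.≤-trans (ℕ.m≤n+m t° v) (proj₂ bounds))
    where
    lemma : ∀ p q i j s° t° u v → q * t° ≡ 1 + p * s° → p * i + q * j ≡ 1 + (p * u + q * v) →
      p * (s° + i) + q * j ≡ p * u + q * (v + t°)
    lemma p q i j s° t° u v qt eq = trans (l₁ p q i j s°) (trans (cong (p * s° +_) eq)
      (trans (l₂ p q u v s°) (trans (cong (_+ (p * u + q * v)) (sym qt)) (l₃ p q u v t°))))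
      where
      l₁ : ∀ p q i j s → p * (s + i) + q * j ≡ p * s + (p * i + q * j)
      l₁ = ℕ-Solver.solve-∀
      l₂ : ∀ p q u v s → p * s + (1 + (p * u + q * v)) ≡ 1 + p * s + (p * u + q * v)
      l₂ = ℕ-Solver.solve-∀
      l₃ : ∀ p q u v t → q * t + (p * u + q * v) ≡ p * u + q * (v + t)
      l₃ = ℕ-Solver.solve-∀

    bounds : s° + i ≤ u × v + t° ≤ j
    bounds = combination-≤ p⊥q (ℕ.<-≤-trans (ℕ.+-monoʳ-< s° i<s) (ℕ.≤-reflexive (sym q≡)))
      (lemma p q i j s° t° u v bezout° eq)

  translate : ∀ k i j → k * r + (p * i + q * j) ≡ p * (i + k * α) + q * (j + k * β)
  translate k i j rewrite r≡ = lemma k p q i j α β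
    where
    lemma : ∀ k p q i j α β → k * (α * p + β * q) + (p * i + q * j) ≡ p * (i + k * α) + q * (j + k * β)
    lemma = ℕ-Solver.solve-∀

  translate¹ : ∀ k i j → k * r + (1 + (p * i + q * j)) ≡ 1 + (p * (i + k * α) + q * (j + k * β))
  translate¹ k i j = trans (ℕ.+-suc (k * r) _) (cong suc (translate k i j))

  -- Since m and r lie in the semigroup, so does k r + m, but n does not. In `minus-plus` the same
  -- comparison is made for m - 1 and n - 1.
  plus-minus : ∀ k {m n} → Plus m → Minus n → n ≢ k * r + m
  plus-minus k (i , j , _ , _ , refl) (_ , (i′ , j′ , i′<s° , j′<t , refl) , refl) eq =
    minus∉ i′<s° j′<t (trans eq (translate k i j))

  minus-plus : ∀ k {m n} → Minus m → Plus n → n ≢ k * r + m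
  minus-plus k (_ , (i , j , _ , _ , refl) , refl) (i′ , j′ , i′<s , j′<t° , refl) eq =
    plus∉ i′<s j′<t° (trans eq (translate¹ k i j))

  -- The coordinates of n are below q and p, hence unique, and must be those of m moved by (suc k)
  -- (α, β). So α and β are at most the coordinates of n, which are below σ and τ.
  box-spread : ∀ k {σ τ m n} → σ ≤ q → τ ≤ p → ¬ (α < σ × β < τ) →
    Box p q σ τ m → Box p q σ τ n → n ≢ suc k * r + m
  box-spread k {σ} {τ} σ≤q τ≤p ¬small (i , j , _ , _ , refl) (i′ , j′ , i′<σ , j′<τ , refl) eq
    with combination-≡ p⊥q (ℕ.<-≤-trans i′<σ σ≤q) (ℕ.<-≤-trans j′<τ τ≤p) (trans eq (translate (suc k) i j))
  ... | refl , refl = ¬small (ℕ.≤-<-trans (bound i α) i′<σ , ℕ.≤-<-trans (bound j β) j′<τ)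
    where
    bound : ∀ x y → y ≤ x + suc k * y
    bound x y = ℕ.≤-trans (ℕ.m≤m+n y (k * y)) (ℕ.m≤n+m _ x)

  -- To be used with P = Ψ (p q r), g = Φ (p q), z = x ^ (q r), w = z - 1 and S = Σ { x ^ (k r) | k
  -- < p }.
  module Product {P g S w z : Poly} (P≈ : P ≈ g ⊗ w ⊗ S) (g≈ : g ⊕ minus ≈ plus) (w≈ : w ⊕ 1ₚ ≈ z)
           (z≈ : z ≈ X ^ (q * r)) (S≈ : S ≈ geo p (X ^ r)) where

    private
      C₊ C₋ Y₊ Y₋ : Poly
      C₊ = S ⊗ plus
      C₋ = S ⊗ minus
      Y₊ = z ⊗ C₊ ⊕ C₋
      Y₋ = z ⊗ C₋ ⊕ C₊

    balance : P ⊕ Y₋ ≈ Y₊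
    balance = ≈-trans (⊕-cong P≈ ≈-refl) (signed-product {g} {w} {plus} {minus} {z} {S} g≈ w≈)

    coeff-balance : ∀ n → coeff P n ℤ.+ coeff Y₋ n ≡ coeff Y₊ n
    coeff-balance n = trans (sym (coeff-⊕ P Y₋ n)) (at balance n)

    module _ (¬small : ¬ (α < s × β < t°)) (¬small° : ¬ (α < s° × β < t)) where

      C₊-indicator : Indicator C₊ (Steps p r Plus)
      C₊-indicator = indicator-resp
        (indicator-geo p r plus-indicator (λ {i} _ m n → box-spread i s≤q t°≤p ¬small n m))
        (⊗-cong (≈-sym S≈) ≈-refl) id id

      C₋-indicator : Indicator C₋ (Steps p r Minus)
      C₋-indicator = indicator-resp
        (indicator-geo p r minus-indicator spread)
        (⊗-cong (≈-sym S≈) ≈-refl) id id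
        where
        spread : ∀ {i m n} → suc i < p → Minus m → Minus n → m ≢ suc i * r + n
        spread {i} _ (m , Bm , refl) (n , Bn , refl) eq = box-spread i s°≤q t≤p ¬small° Bn Bm
          (ℕ.suc-injective (trans eq (ℕ.+-suc (suc i * r) n)))

      z-indicator : ∀ {f A} → Indicator f A → Indicator (z ⊗ f) (Shift (q * r) A)
      z-indicator I = indicator-resp (indicator-X^ (q * r) I) (⊗-cong (≈-sym z≈) ≈-refl) id id

      -- A shift by q exceeds any number of steps k < p, so that the two
      -- conflicting elements differ by a natural multiple of r.
      steps-disjoint : ∀ {A B : ℕ → Set} → (∀ k {m n} → A m → B n → n ≢ k * r + m) →
        ∀ {n} → Shift (q * r) (Steps p r A) n → Steps p r B n → ⊥
      steps-disjoint {A} {B} apart (_ , (k , _ , a , Aa , refl) , refl) (k′ , k′<p , b , Bb , eq) =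
        apart d Aa Bb (ℕ.+-cancelˡ-≡ (k′ * r) b (d * r + a) (begin
          k′ * r + b              ≡⟨ eq ⟨
          q * r + (k * r + a)     ≡⟨ regroup q k r a ⟨
          (q + k) * r + a         ≡⟨ cong (λ e → e * r + a) (ℕ.m+[n∸m]≡n k′≤q+k) ⟨
          (k′ + d) * r + a        ≡⟨ regroup k′ d r a ⟩
          k′ * r + (d * r + a)    ∎))
        where
        open ≡-Reasoning
        d : ℕ
        d = q + k ∸ k′

        k′≤q+k : k′ ≤ q + k
        k′≤q+k = ℕ.≤-trans (ℕ.<⇒≤ (ℕ.<-trans k′<p p<q)) (ℕ.m≤m+n q k)

        regroup : ∀ m n r a → (m + n) * r + a ≡ m * r + (n * r + a)
        regroup = ℕ-Solver.solve-∀

      Y₊-indicator : Indicator Y₊ (λ n → Shift (q * r) (Steps p r Plus) n ⊎ Steps p r Minus n)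
      Y₊-indicator = indicator-⊕ (z-indicator C₊-indicator) C₋-indicator (steps-disjoint plus-minus)

      Y₋-indicator : Indicator Y₋ (λ n → Shift (q * r) (Steps p r Minus) n ⊎ Steps p r Plus n)
      Y₋-indicator = indicator-⊕ (z-indicator C₋-indicator) C₊-indicator (steps-disjoint minus-plus)

      coeff-bounded : ∀ n → ℤ.∣ coeff P n ∣ ≤ 1
      coeff-bounded n = bounded {coeff P n} (coeff-balance n) (value Y₋-indicator) (value Y₊-indicator)
        where
        value : ∀ {f A} → Indicator f A → coeff f n ≡ 1ℤ ⊎ coeff f n ≡ 0ℤ
        value I with split I n
        ... | inj₁ (_ , eq) = inj₁ eq
        ... | inj₂ (_ , eq) = inj₂ eq

        bounded : ∀ {x y w} → x ℤ.+ y ≡ w → y ≡ 1ℤ ⊎ y ≡ 0ℤ → w ≡ 1ℤ ⊎ w ≡ 0ℤ → ℤ.∣ x ∣ ≤ 1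
        bounded {x} {y} {w} eq y∈ w∈ rewrite difference x y w eq with y∈ | w∈
        ... | inj₁ refl | inj₁ refl = z≤n
        ... | inj₁ refl | inj₂ refl = s≤s z≤n
        ... | inj₂ refl | inj₁ refl = s≤s z≤n
        ... | inj₂ refl | inj₂ refl = z≤n

      -- Excludes height 0. The exponent 0 occurs in `plus` and so in `Y₋`, while the exponents in
      -- `Y₊` are at least q r or at least 1.
      coeff-0 : coeff P 0 ≡ -1ℤ
      coeff-0 = trans (difference _ _ _ (coeff-balance 0))
        (cong₂ ℤ._-_ (indicator-∉ Y₊-indicator absent) (indicator-∈ Y₋-indicator present))
        where
        present : Shift (q * r) (Steps p r Minus) 0 ⊎ Steps p r Plus 0
        present = inj₂ (0 , ℕ.<-trans z<s 1<p , 0 , (0 , 0 , 0<s , 0<t° , origin p q) , refl)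
          where
          origin : ∀ p q → 0 ≡ p * 0 + q * 0
          origin = ℕ-Solver.solve-∀

        absent : ¬ (Shift (q * r) (Steps p r Plus) 0 ⊎ Steps p r Minus 0)
        absent (inj₁ (a , _ , eq)) =
          ℕ.<⇒≢ (ℕ.<-≤-trans (ℕ.*-mono-< 0<q (ℕ.<-trans z<s 1<r)) (ℕ.m≤m+n (q * r) a)) eq
        absent (inj₂ (k , _ , _ , (_ , _ , refl) , eq)) with () ← trans eq (ℕ.+-suc (k * r) _)

      flat : Flat P
      flat = ℕ.≤-antisym (height-≤ P coeff-bounded)
        (subst (λ c → ℤ.∣ c ∣ ≤ height P) coeff-0 (coeff≤height P 0))

    private
      Xʳ⊗-low : ∀ f {m} → m < r → coeff (X ^ r ⊗ (X ^ r ⊗ f)) (r + m) ≡ 0ℤ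
      Xʳ⊗-low f {m} m<r = trans (coeff-X^⊗ r (X ^ r ⊗ f) m) (coeff-X^⊗-< f m<r)

    -- For exponents below 2 r, multiples of y ² with y = x ^ r do not contribute, so `P` agrees
    -- there with -(1 + y) g.
    coeff-middle : ∀ {m} → m < r → coeff P (r + m) ℤ.+ (coeff g (r + m) ℤ.+ coeff g m) ≡ 0ℤ
    coeff-middle {m} m<r with low-order {g = g} {w} {X ^ r} 1<p (ℕ.<-trans 1<p p<q)
      (≈-trans w≈ (≈-trans z≈ (≈-trans (^-congʳ X (ℕ.*-comm q r)) (≈-sym (^-assocʳ X r q)))))
    ... | k , l , eq = begin
      coeff P n ℤ.+ (coeff g n ℤ.+ coeff g m)
        ≡⟨ cong₂ (λ x y → x ℤ.+ (coeff g n ℤ.+ y)) (at (≈-trans P≈ (⊗-congˡ (g ⊗ w) S≈)) n) (sym shifted) ⟩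
      coeff Q n ℤ.+ (coeff g n ℤ.+ coeff (X ^ r ⊗ g ⊕ X ^ r ⊗ (X ^ r ⊗ k)) n)
        ≡⟨ cong (ℤ._+_ (coeff Q n)) (coeff-⊕ g _ n) ⟨
      coeff Q n ℤ.+ coeff (g ⊕ (X ^ r ⊗ g ⊕ X ^ r ⊗ (X ^ r ⊗ k))) n
        ≡⟨ coeff-⊕ Q _ n ⟨
      coeff (Q ⊕ (g ⊕ (X ^ r ⊗ g ⊕ X ^ r ⊗ (X ^ r ⊗ k)))) n
        ≡⟨ at eq n ⟩
      coeff (X ^ r ⊗ (X ^ r ⊗ l)) n
        ≡⟨ Xʳ⊗-low l m<r ⟩
      0ℤ ∎
      where
      open ≡-Reasoning
      n : ℕ
      n = r + m
      Q : Poly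
      Q = g ⊗ w ⊗ geo p (X ^ r)
      shifted : coeff (X ^ r ⊗ g ⊕ X ^ r ⊗ (X ^ r ⊗ k)) n ≡ coeff g m
      shifted = trans (coeff-⊕ (X ^ r ⊗ g) _ n)
        (trans (cong₂ ℤ._+_ (coeff-X^⊗ r g m) (Xʳ⊗-low k m<r)) (ℤ.+-identityʳ _))

    -- By `coeff-middle` the coefficient of `P` at r + m is -(x + x).
    flat⇒¬repeated : Flat P → ∀ {m x} → m < r → coeff g m ≡ x → coeff g (r + m) ≡ x → 2 ≤ ℤ.∣ x ℤ.+ x ∣ → ⊥
    flat⇒¬repeated is-flat {m} {x} m<r eq eq′ 2≤ =
      ℕ.<⇒≱ 2≤ (subst (_≤ 1) ∣P∣ (ℕ.≤-trans (coeff≤height P (r + m)) (ℕ.≤-reflexive is-flat)))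
      where
      ∣P∣ : ℤ.∣ coeff P (r + m) ∣ ≡ ℤ.∣ x ℤ.+ x ∣
      ∣P∣ = trans
        (cong ℤ.∣_∣ (trans (difference (coeff P (r + m)) _ _ (coeff-middle m<r))
          (trans (ℤ.+-identityˡ _) (cong ℤ.-_ (cong₂ ℤ._+_ eq′ eq)))))
        (ℤ.∣-i∣≡∣i∣ (x ℤ.+ x))

    coeff-g : ∀ n → coeff g n ≡ coeff plus n ℤ.- coeff minus n
    coeff-g n = difference _ _ _ (trans (sym (coeff-⊕ g minus n)) (at g≈ n))

    coeff-g-Plus : ∀ {n} → Plus n → coeff g n ≡ 1ℤ
    coeff-g-Plus {n} b = trans (coeff-g n) (cong₂ ℤ._-_ (indicator-∈ plus-indicator b)
      -- With k = 0, `plus-minus` says that `Plus` and `Minus` are disjoint.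
      (indicator-∉ minus-indicator (λ b′ → plus-minus 0 b b′ refl)))

    coeff-g-Minus : ∀ {n} → Minus n → coeff g n ≡ -1ℤ
    coeff-g-Minus {n} b = trans (coeff-g n) (cong₂ ℤ._-_
      (indicator-∉ plus-indicator (λ b′ → minus-plus 0 b b′ refl)) (indicator-∈ minus-indicator b))

    -- Under the two bounds both 0 and r are in `Plus`, with coordinates (0, 0) and (α, β), so `P`
    -- has the coefficient -2 at x ^ r.
    flat⇒¬small : Flat P → ¬ (α < s × β < t°)
    flat⇒¬small is-flat (α<s , β<t°) = flat⇒¬repeated is-flat {0} (ℕ.<-trans z<s 1<r)
      (coeff-g-Plus (0 , 0 , 0<s , 0<t° , sym (cong₂ _+_ (ℕ.*-zeroʳ p) (ℕ.*-zeroʳ q))))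
      (coeff-g-Plus (α , β , α<s , β<t° , trans (ℕ.+-identityʳ r) r≡′)) ℕ.≤-refl

    -- Here 1 and r + 1 are both in `Minus`, again from (0, 0) and (α, β), so `P` has the
    -- coefficient 2 at x ^ (r + 1).
    flat⇒¬small° : Flat P → ¬ (α < s° × β < t)
    flat⇒¬small° is-flat (α<s° , β<t) = flat⇒¬repeated is-flat {1} 1<r
      (coeff-g-Minus (0 , (0 , 0 , 0<s° , 0<t , sym (cong₂ _+_ (ℕ.*-zeroʳ p) (ℕ.*-zeroʳ q))) , refl))
      (coeff-g-Minus (r , (α , β , α<s° , β<t , r≡′) , ℕ.+-comm r 1)) ℕ.≤-refl

-- Modular inverses as Bézout coefficients, and the conclusion

inverse-equation : ∀ {n a a′} → 0 < a → IsInverseMod n a a′ → ∃ λ k → a * a′ ≡ 1 + n * k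
inverse-equation {n} {a} {a′} 0<a I with IsInverseMod.inverse I
... | divides k eq = k , (let open ≡-Reasoning in begin
    a * a′                 ≡⟨ ℕ.m+[n∸m]≡n 1≤aa′ ⟨
    1 + (a * a′ ∸ 1)       ≡⟨ cong suc (ℕ.m≤n⇒∣n-m∣≡n∸m 1≤aa′) ⟨
    1 + ∣ a * a′ - 1 ∣     ≡⟨ cong suc (trans eq (ℕ.*-comm k n)) ⟩
    1 + n * k              ∎)
  where
  1≤aa′ : 1 ≤ a * a′
  1≤aa′ = ℕ.*-mono-< 0<a (IsInverseMod.positive I)

-- Write p p′ = 1 + q k and q q′ = 1 + p l. Then q (k + q′) = p (p′ + l), so p divides k + q′. From
-- q k < p p′ < p q follows k < p, so 0 < k + q′ < 2 p leaves only k + q′ = p.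
inverses-bezout : ∀ {p q p′ q′} → 0 < p → 0 < q → Coprime p q → IsInverseMod q p p′ → IsInverseMod p q q′ →
  p * p′ ≡ 1 + q * (p ∸ q′)
inverses-bezout {p} {q} {p′} {q′} 0<p 0<q p⊥q I J with inverse-equation 0<p I | inverse-equation 0<q J
... | k , eq | l , eq′ = trans eq (cong (λ x → 1 + q * x) k≡)
  where
  module I = IsInverseMod I
  module J = IsInverseMod J
  instance
    p≢0 : NonZero p
    p≢0 = >-nonZero 0<p

  k<p : k < p
  k<p = ℕ.*-cancelˡ-< q k p (ℕ.<-trans (ℕ.≤-reflexive (sym eq))
    (ℕ.<-≤-trans (ℕ.*-monoʳ-< p I.bounded) (ℕ.≤-reflexive (ℕ.*-comm p q))))

  sum : q * (k + q′) ≡ p * (p′ + l)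
  sum = let open ≡-Reasoning in begin
    q * (k + q′)          ≡⟨ ℕ.*-distribˡ-+ q k q′ ⟩
    q * k + q * q′        ≡⟨ cong (q * k +_) eq′ ⟩
    q * k + (1 + p * l)   ≡⟨ ℕ.+-suc (q * k) (p * l) ⟩
    1 + q * k + p * l     ≡⟨ cong (_+ p * l) eq ⟨
    p * p′ + p * l        ≡⟨ ℕ.*-distribˡ-+ p p′ l ⟨
    p * (p′ + l)          ∎

  p∣k+q′ : p ∣ k + q′
  p∣k+q′ = coprime-divisor p⊥q (subst (p ∣_) (sym sum) (m∣m*n (p′ + l)))

  k+q′≡p : k + q′ ≡ p
  k+q′≡p with p∣k+q′
  ... | divides zero          e = contradiction e (ℕ.>⇒≢ (ℕ.<-≤-trans J.positive (ℕ.m≤n+m q′ k)))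
  ... | divides (suc zero)    e = trans e (ℕ.*-identityˡ p)
  ... | divides (suc (suc c)) e = contradiction (ℕ.+-mono-< k<p J.bounded)
          (ℕ.≤⇒≯ (ℕ.≤-trans (ℕ.+-monoʳ-≤ p (ℕ.m≤m+n p (c * p))) (ℕ.≤-reflexive (sym e))))

  k≡ : k ≡ p ∸ q′
  k≡ = trans (sym (ℕ.m+n∸n≡m k q′)) (cong (_∸ q′) k+q′≡p)

theorem2 : ∀ (p q r : ℕ) → Prime p → Prime q → Prime r →
    2 ∤ p → 2 ∤ q → 2 ∤ r → p < q → q < r →
    ∀ (α β : ℕ) → α > 0 → β > 0 →
    r ≡ α * p + β * q → r ≤ φ (p * q) →
    ∀ (p′ q′ : ℕ) → IsInverseMod q p p′ → IsInverseMod p q q′ →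
    Flat (Ψ (p * q * r)) ⇔
    ( (α ≥ p′ ⊔ (q ∸ p′))
    ⊎ (β ≥ q′ ⊔ (p ∸ q′))
    ⊎ (α ≥ p′ × β ≥ p ∸ q′)
    ⊎ (α ≥ q ∸ p′ × β ≥ q′) )
theorem2 p q r pp pq pr _ _ _ p<q q<r α β _ _ r≡ _ p′ q′ I J = mk⇔
  (λ is-flat → cases (Flatness.flat⇒¬small is-flat) (Flatness.flat⇒¬small° is-flat))
  (λ c → Flatness.flat (¬small c) (¬small° c))
  where
  module I = IsInverseMod I
  module J = IsInverseMod J

  p⊥q : Coprime p q
  p⊥q = ⊥-sym (prime⇒coprime pq {{prime⇒nonZero pp}} p<q)

  bezout : p * p′ ≡ 1 + q * (p ∸ q′)
  bezout = inverses-bezout (prime⇒>0 pp) (prime⇒>0 pq) p⊥q I J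

  bezout° : q * q′ ≡ 1 + p * (q ∸ p′)
  bezout° = inverses-bezout (prime⇒>0 pq) (prime⇒>0 pp) (⊥-sym p⊥q) J I

  q≡ : q ≡ (q ∸ p′) + p′
  q≡ = sym (ℕ.m∸n+n≡m (ℕ.<⇒≤ I.bounded))

  p≡ : p ≡ q′ + (p ∸ q′)
  p≡ = sym (ℕ.m+[n∸m]≡n (ℕ.<⇒≤ J.bounded))

  module Criterion = FlatnessCriterion {α = α} {β} p⊥q
    (nonTrivial⇒n>1 p {{prime⇒nonTrivial pp}}) p<q q<r r≡ q≡ p≡
    I.positive (ℕ.m<n⇒0<n∸m I.bounded) (ℕ.m<n⇒0<n∸m J.bounded) J.positive bezout bezout°

  g z w : Poly
  g = bezoutQuotient p q p′ (p ∸ q′) X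
  z = (X ^ r) ^ q
  w = z ⊖ 1ₚ

  Ψ≈ : Ψ (p * q * r) ≈ g ⊗ w ⊗ geo p (X ^ r)
  Ψ≈ = Ψ-pqr {s = p′} pp pq pr p<q q<r bezout

  g≈ : g ⊕ Criterion.minus ≈ Criterion.plus
  g≈ = ≈-trans (⊕-cong (bezoutQuotient-explicit {p} {q} {p′} bezout X q≡ p≡ bezout°) (≈-refl {Criterion.minus}))
    (//-rightDividesˡ Criterion.minus Criterion.plus)

  w≈ : w ⊕ 1ₚ ≈ z
  w≈ = //-rightDividesˡ 1ₚ z

  z≈ : z ≈ X ^ (q * r)
  z≈ = ≈-trans (^-assocʳ X r q) (^-congʳ X (ℕ.*-comm r q))

  module Flatness = Criterion.Product {g = g} {w = w} {z = z} Ψ≈ g≈ w≈ z≈ ≈-refl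

  -- The four alternatives are what results from multiplying out (α ≥ p′ or β ≥ q′) and (α ≥ q - p′
  -- or β ≥ p - q′), the negations of the two collision cases.
  Condition : Set
  Condition = (α ≥ p′ ⊔ (q ∸ p′)) ⊎ (β ≥ q′ ⊔ (p ∸ q′)) ⊎ (α ≥ p′ × β ≥ p ∸ q′) ⊎ (α ≥ q ∸ p′ × β ≥ q′)

  ¬small : Condition → ¬ (α < p′ × β < q′)
  ¬small (inj₁ c)                      (α< , _) = ℕ.<⇒≱ α< (ℕ.m⊔n≤o⇒m≤o p′ _ c)
  ¬small (inj₂ (inj₁ c))               (_ , β<) = ℕ.<⇒≱ β< (ℕ.m⊔n≤o⇒m≤o q′ _ c)
  ¬small (inj₂ (inj₂ (inj₁ (c , _)))) (α< , _) = ℕ.<⇒≱ α< c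
  ¬small (inj₂ (inj₂ (inj₂ (_ , c)))) (_ , β<) = ℕ.<⇒≱ β< c

  ¬small° : Condition → ¬ (α < q ∸ p′ × β < p ∸ q′)
  ¬small° (inj₁ c)                      (α< , _) = ℕ.<⇒≱ α< (ℕ.m⊔n≤o⇒n≤o p′ _ c)
  ¬small° (inj₂ (inj₁ c))               (_ , β<) = ℕ.<⇒≱ β< (ℕ.m⊔n≤o⇒n≤o q′ _ c)
  ¬small° (inj₂ (inj₂ (inj₁ (_ , c)))) (_ , β<) = ℕ.<⇒≱ β< c
  ¬small° (inj₂ (inj₂ (inj₂ (c , _)))) (α< , _) = ℕ.<⇒≱ α< c

  cases : ¬ (α < p′ × β < q′) → ¬ (α < q ∸ p′ × β < p ∸ q′) → Condition
  cases ¬s ¬s° with ℕ.<-≤-connex α p′ | ℕ.<-≤-connex α (q ∸ p′)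
  ... | inj₂ c  | inj₂ c° = inj₁ (ℕ.⊔-lub c c°)
  ... | inj₂ c  | inj₁ α< = inj₂ (inj₂ (inj₁ (c , ℕ.≮⇒≥ (λ β< → ¬s° (α< , β<)))))
  ... | inj₁ α< | inj₂ c° = inj₂ (inj₂ (inj₂ (c° , ℕ.≮⇒≥ (λ β< → ¬s (α< , β<)))))
  ... | inj₁ α< | inj₁ α<° = inj₂ (inj₁ (ℕ.⊔-lub (ℕ.≮⇒≥ (λ β< → ¬s (α< , β<))) (ℕ.≮⇒≥ (λ β< → ¬s° (α<° , β<)))))
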